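{- There is an absolute constant $C>0$ such that for every instance $I$ of SRMA (min-max submodular ranking for multiple agents) with integer weights, every permutation $\pi$ output by the Balanced Adaptive Greedy algorithm on $I$ (with any tie-breaking) satisfies $$\max_{i\in[k]}\sum_{j=1}^m w^{(i)}_j\,\mathrm{cov}(f^{(i)}_j,\pi)\ \le\ C\,\bigl(1+\ln(1/\epsilon)\bigr)\bigl(1+\log\min\{n,W\}\bigr)\bigl(1+\log k\bigr)\cdot \mathrm{OPT}(I).$$ That is, the algorithm has approximation ratio $O(\ln(1/\epsilon)\cdot\log(\min\{n,W\})\cdot\log k)$, where $n$ is the number of elements, $k$ is the number of agents, $\epsilon$ is the minimum non-zero marginal value among all $m\cdot k$ functions, and $W$ is the maximum total weight of all functions of an agent, over all agents.
   Context: **SRMA.** An instance consists of a ground set $U=[n]$, $k$ agents $a_1,\dots,a_k$ (set $A$), and for each agent $a_i$, monotone submodular functions $f^{(i)}_1,\dots,f^{(i)}_m:2^{[n]}\to[0,1]$ with $f^{(i)}_j(U)=1$ and weights $w^{(i)}_j\ge 1$. For a permutation $\pi$ of $U$, let $\pi(t)$ be its $t$-th element, $\pi_t=\{\pi(1),\dots,\pi(t)\}$, $\pi_0=\emptyset$. The cover time $\mathrm{cov}(f,\pi)$ is the smallest index $t\in\{1,\dots,n\}$ with $f(\pi_t)=1$. The objective value of $\pi$ is $\max_{i\in[k]}\sum_{j=1}^m w^{(i)}_j\mathrm{cov}(f^{(i)}_j,\pi)$, and $\mathrm{OPT}(I)$ is its minimum over all permutations. $\epsilon>0$ is the minimum non-zero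 marginal value: for all $S\subseteq S'$, $f^{(i)}_j(S')>f^{(i)}_j(S)$ implies $f^{(i)}_j(S')-f^{(i)}_j(S)\ge\epsilon$. $W=\max_{i}\sum_{j=1}^m w^{(i)}_j$. **Balanced Adaptive Greedy.** Elements are selected one per time $t=1,2,\dots$. Let $R^{(i)}_t$ be the set of functions of agent $a_i$ not satisfied earlier than time $t$, i.e. those $f^{(i)}_j$ with $f^{(i)}_j(\pi_{t-1})<1$, and let $w(R^{(i)}_t)$ be their total weight. Let $B_p=(2/3)^pW$. For $p=1,2,\dots$ (outer iterations), until all functions are satisfied, do the following. While the current set $\{a_i\in A: w(R^{(i)}_t)>B_p\}$ is non-empty, run inner iterations $q=1,2,\dots$: at the start of inner iteration $(p,q)$ fix $A'=\{a_i\in A: w(R^{(i)}_t)>B_p\}$ ($t$ the current time); then, as long as $|\{a_i\in A: w(R^{(i)}_t)>B_p\}|\ge\frac34|A'|$ and this set is non-empty, choose $\pi(t)\in U\setminus\pi_{t-1}$ maximizing $$F_{\pi_{t-1}}(e)=\sum_{a_i\in A'}\ \sum_{j:\,f^{(i)}_j(\pi_{t-1})<1} w^{(i)}_j\,\frac{f^{(i)}_j(\pi_{t-1}\cup\{e\})-f^{(i)}_j(\pi_{t-1})}{1-f^{(i)}_j(\pi_{t-1})}$$ and increase $t$ by 1. When no agent has $w(R^{(i)}_t)>B_p$, move on to $p+1$ (an outer iteration may be empty). Any elements left over once all functions are satisfied are appended in arbitrary order. -}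

module Defs where

open import Level using (0ℓ)
open import Algebra.Bundles using (CommutativeRing; Semiring)
open import Algebra.Definitions.RawMonoid using () renaming (sum to sumOf)
import Algebra.Definitions.RawSemiring as SemiringOps
open import Data.Bool.Base using (if_then_else_)
open import Data.Fin.Base using (Fin; toℕ)
open import Data.Fin.Permutation using (Permutation′; _⟨$⟩ʳ_; _⟨$⟩ˡ_)
open import Data.Fin.Subset
  using (Subset; _∈_; _∉_; _⊆_; _∪_; _∩_; ⊤; ⁅_⁆; ∣_∣; Nonempty)
open import Data.Fin.Subset.Properties using (_∈?_)
open import Data.Nat.Base as ℕ using (ℕ; zero; suc; _!)
import Data.Nat.Properties as ℕₚ
open import Data.Product.Base using (∃; ∃-syntax; _×_)
open import Data.Sum.Base using (_⊎_)
open import Data.Vec.Base using (tabulate)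
import Data.Vec.Functional as Vector
open import Relation.Binary.Core using (Rel)
open import Relation.Binary.PropositionalEquality using (_≡_)
open import Relation.Binary.Structures using (IsStrictTotalOrder)
open import Relation.Nullary using (¬_; Dec; does)

-- The standard library has no real numbers, so ℝ is given by its classical
-- axioms: a Dedekind-complete ordered field, unique up to isomorphism.  The
-- order is trichotomous, hence _<_ and _≈_ are decidable.
record Reals : Set₁ where
  field
    commutativeRing : CommutativeRing 0ℓ 0ℓ

  open CommutativeRing commutativeRing public

  infix  4 _<_ _≤_
  infix  8 _⁻¹
  infixl 7 _/_

  field
    -- The value of 0# ⁻¹ is unspecified.
    _⁻¹                : Carrier → Carrier
    ⁻¹-inverse         : ∀ x → ¬ (x ≈ 0#) → x * x ⁻¹ ≈ 1#
    _<_                : Rel Carrier 0ℓ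
    isStrictTotalOrder : IsStrictTotalOrder _≈_ _<_
    0<1                : 0# < 1#
    +-monoˡ-<          : ∀ z {x y} → x < y → x + z < y + z
    *-positive         : ∀ {x y} → 0# < x → 0# < y → 0# < x * y

  _≤_ : Rel Carrier 0ℓ
  x ≤ y = (x < y) ⊎ (x ≈ y)

  UpperBound : (Carrier → Set) → Carrier → Set
  UpperBound P b = ∀ x → P x → x ≤ b

  field
    supremum : (P : Carrier → Set) → ∃ P → ∃ (UpperBound P) →
               ∃[ s ] UpperBound P s × (∀ b → UpperBound P b → s ≤ b)

  open IsStrictTotalOrder isStrictTotalOrder public
    using (compare; _<?_; _≟_)

  open SemiringOps (Semiring.rawSemiring semiring) public
    using (sum; _^_) renaming (_×_ to _·_)

  _/_ : Carrier → Carrier → Carrier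
  x / y = x * y ⁻¹

  fromℕ : ℕ → Carrier
  fromℕ n = n · 1#

  _ConvergesTo_ : (ℕ → Carrier) → Carrier → Set
  s ConvergesTo x = ∀ δ → 0# < δ →
    ∃[ N ] ∀ M → N ℕ.≤ M → (x - δ < s M) × (s M < x + δ)

  expSeries : Carrier → ℕ → Carrier
  expSeries y N = sum {N} λ i → y ^ toℕ i / fromℕ (toℕ i !)

  -- y = ln x, i.e. exp y = x.
  IsLn : Carrier → Carrier → Set
  IsLn x y = expSeries y ConvergesTo x

sumℕ : ∀ {n} → (Fin n → ℕ) → ℕ
sumℕ = sumOf ℕ.+-0-rawMonoid

maxℕ : ∀ {n} → (Fin n → ℕ) → ℕ
maxℕ = Vector.foldr ℕ._⊔_ 0

-- The first t′ ∈ {t, …, t + d ∸ 1} satisfying P, or t + d if there is none.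
firstFrom : {P : ℕ → Set} → (∀ t → Dec (P t)) → (t d : ℕ) → ℕ
firstFrom P? t zero    = t
firstFrom P? t (suc d) = if does (P? t) then t else firstFrom P? (suc t) d

-- π_t = {π(1), …, π(t)}, as the set of elements whose position (counted from 0)
-- is below t.
prefix : ∀ {n} → Permutation′ n → ℕ → Subset n
prefix π t = tabulate λ x → does (toℕ (π ⟨$⟩ˡ x) ℕₚ.<? t)

module _ (ℛ : Reals) where
  open Reals ℛ

  record IsMonotoneSubmodular {n} (f : Subset n → Carrier) : Set where
    field
      monotone   : ∀ {S T} → S ⊆ T → f S ≤ f T
      submodular : ∀ S T → f (S ∪ T) + f (S ∩ T) ≤ f S + f T

  -- SRMA instances with integer weights, on n elements, k agents and m functions
  -- per agent.
  record SRMA (n k m : ℕ) : Set where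
    field
      0<n    : 0 ℕ.< n
      0<k    : 0 ℕ.< k
      0<m    : 0 ℕ.< m
      f      : Fin k → Fin m → Subset n → Carrier
      f-ms   : ∀ i j → IsMonotoneSubmodular (f i j)
      f-≥0   : ∀ i j S → 0# ≤ f i j S
      f-≤1   : ∀ i j S → f i j S ≤ 1#
      f-full : ∀ i j → f i j ⊤ ≈ 1#
      w      : Fin k → Fin m → ℕ
      1≤w    : ∀ i j → 1 ℕ.≤ w i j

  module _ {n k m : ℕ} (I : SRMA n k m) where
    open SRMA I

    W : ℕ
    W = maxℕ λ i → sumℕ (w i)

    NonzeroMarginal : Fin k → Fin m → Subset n → Subset n → Set
    NonzeroMarginal i j S S′ = S ⊆ S′ × f i j S < f i j S′

    -- If every function is constant there is no non-zero marginal value; then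
    -- ε = 1 by convention.
    record IsMinNonzeroMarginal (ε : Carrier) : Set where
      field
        positive   : 0# < ε
        lowerBound : ∀ i j S S′ → NonzeroMarginal i j S S′ →
                     ε ≤ f i j S′ - f i j S
        attained   : (∃[ i ] ∃[ j ] ∃[ S ] ∃[ S′ ]
                        NonzeroMarginal i j S S′ × f i j S′ - f i j S ≈ ε)
                   ⊎ ((∀ i j S S′ → ¬ NonzeroMarginal i j S S′) × ε ≈ 1#)

    -- Since f U = 1, the search over {1, …, n ∸ 1} may default to n.
    cov : (Subset n → Carrier) → Permutation′ n → ℕ
    cov g π = firstFrom (λ t → g (prefix π t) ≟ 1#) 1 (n ℕ.∸ 1)

    objective : Permutation′ n → ℕ
    objective π = maxℕ λ i → sumℕ λ j → w i j ℕ.* cov (f i j) π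

    IsOPT : ℕ → Set
    IsOPT o = (∃[ σ ] objective σ ≡ o) × (∀ σ → o ℕ.≤ objective σ)

    -- In what follows S is the set of elements selected so far, π_{t-1}.

    -- w(R^{(i)}_t)
    unsatisfiedWeight : Subset n → Fin k → ℕ
    unsatisfiedWeight S i =
      sumℕ λ j → if does (f i j S <? 1#) then w i j else 0

    -- {aᵢ : w(R^{(i)}_t) > B_p}, where B_p = (2/3)^p W with the denominator
    -- cleared.
    heavy : ℕ → Subset n → Subset k
    heavy p S = tabulate λ i →
      does (2 ℕ.^ p ℕ.* W ℕₚ.<? 3 ℕ.^ p ℕ.* unsatisfiedWeight S i)

    -- F_S(e), for the fixed set A′ of agents
    score : Subset k → Subset n → Fin n → Carrier
    score A′ S e = sum λ i → if does (i ∈? A′) then agentScore i else 0#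
      where
      agentScore : Fin k → Carrier
      agentScore i = sum λ j →
        if does (f i j S <? 1#)
        then fromℕ (w i j) * ((f i j (S ∪ ⁅ e ⁆) - f i j S) / (1# - f i j S))
        else 0#

    IsGreedyChoice : Subset k → Subset n → Fin n → Set
    IsGreedyChoice A′ S e = e ∉ S × (∀ e′ → e′ ∉ S → score A′ S e′ ≤ score A′ S e)

    AllSatisfied : Subset n → Set
    AllSatisfied S = ∀ i j → f i j S ≈ 1#

    -- Big-step semantics of the algorithm, as constraints on the permutation π it
    -- outputs.  The state is the number s = t - 1 of elements selected so far;
    -- ties are resolved by π itself.
    module _ (π : Permutation′ n) where

      Continue : ℕ → Subset k → ℕ → Set
      Continue p A′ s = 3 ℕ.* ∣ A′ ∣ ℕ.≤ 4 ℕ.* ∣ heavy p (prefix π s) ∣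
                      × Nonempty (heavy p (prefix π s))

      -- One inner iteration (p, q) with its set A′ leads from s to s′.
      data Inner (p : ℕ) (A′ : Subset k) : (s s′ : ℕ) → Set where
        stop   : ∀ {s} → ¬ Continue p A′ s → Inner p A′ s s
        select : ∀ {s s′} → Continue p A′ s →
                 (t : Fin n) → toℕ t ≡ s →
                 IsGreedyChoice A′ (prefix π s) (π ⟨$⟩ʳ t) →
                 Inner p A′ (suc s) s′ → Inner p A′ s s′

      -- The inner iterations of outer iteration p lead from s to s′.
      data Outer (p : ℕ) : (s s′ : ℕ) → Set where
        exit : ∀ {s} → ¬ Nonempty (heavy p (prefix π s)) → Outer p s s
        iter : ∀ {s s′ s″} → Nonempty (heavy p (prefix π s)) →
               Inner p (heavy p (prefix π s)) s s′ →
               Outer p s′ s″ → Outer p s s″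

      -- The outer iterations p, p+1, … started at s terminate.  The order of the
      -- elements left over at the end is unconstrained.
      data Run : (p s : ℕ) → Set where
        done : ∀ {p s} → AllSatisfied (prefix π s) → Run p s
        next : ∀ {p s s′} → ¬ AllSatisfied (prefix π s) →
               Outer p s s′ → Run (suc p) s′ → Run p s

    IsBAGOutput : Permutation′ n → Set
    IsBAGOutput π = Run π 1 0

{-# OPTIONS --safe #-}
module Submission where

-- Fix an optimal permutation σ and a phase p with threshold B = B_p, and let
-- L ≈ 2 OPT / B.  The functions of an agent not covered by the first L elements
-- of σ weigh at most OPT / L ≤ B / 2, so for each agent with unsatisfied weight
-- above B these L elements jointly gain at least B / 2.  As at least 3/4 of the
-- agents in A′ are still heavy, the greedy element scores at least
-- (3/4) |A′| B / (2 L).  The scores of one inner iteration sum to at most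
-- O(1 + ln (1/ε)) |A′| B, which bounds its length by O(1 + ln (1/ε)) L.  Each
-- inner iteration removes a quarter of the heavy agents, so a phase has
-- O(1 + ln k) of them and, every agent having weight at most (3/2) B, costs
-- O((1 + ln (1/ε)) (1 + ln k)) OPT.  After O(1 + ln min {n, W}) phases the
-- remaining weight is below W / n or zero, and the rest costs at most W ≤ OPT.
--
-- The logarithms are replaced by counting powers of ρ = 4/3, for which only
-- (4/3)^N ≤ e^y ⇒ N ≤ 4 y and 1 ≤ e^y ⇒ 0 ≤ y are needed.

open import Defs
import Algebra.Properties.Ring as RingProperties
import Algebra.Properties.Semiring.Mult as Mult
import Algebra.Properties.Semiring.Mult.TCOptimised as Mult′
import Algebra.Properties.Semiring.Sum as SemiringSum
import Algebra.Solver.Ring as RingSolver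
open import Algebra.Solver.Ring.AlmostCommutativeRing
  using (fromCommutativeRing; _-Raw-AlmostCommutative⟶_)
open import Data.Bool.Base using (if_then_else_)
open import Data.Empty using (⊥; ⊥-elim)
open import Data.Fin.Base using (Fin; toℕ; fromℕ<) renaming (zero to fzero; suc to fsuc)
open import Data.Fin.Permutation using (Permutation′; _⟨$⟩ʳ_; _⟨$⟩ˡ_; inverseˡ; inverseʳ)
import Data.Fin.Properties as Finₚ
open import Data.Fin.Subset
  using (Subset; _∈_; _⊆_; _∪_; _∩_; ⊤; ⁅_⁆; ∣_∣; Nonempty; inside; outside)
open import Data.Fin.Subset.Properties
  using (_∈?_; p⊆p∪q; q⊆p∪q; x∈p∪q⁻; x∈p∪q⁺; x∈p∩q⁺; x∈⁅x⁆; x∈⁅y⁆⇒x≡y; p⊆q⇒∣p∣≤∣q∣;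
         ∣p∣≤n; Empty-unique; ∣⊥∣≡0; ∣⁅x⁆∣≡1; ⊆⊤)
open import Data.Integer.Base as ℤ using (ℤ; +_; -[1+_])
import Data.Integer.Properties as ℤₚ
open import Data.Maybe.Base using (Maybe; just; nothing)
open import Data.Nat.Base as ℕ using (ℕ; zero; suc; _!)
import Data.Nat.Properties as ℕₚ
open import Data.Nat.Solver using (module +-*-Solver)
open import Data.Product.Base using (∃-syntax; _×_; _,_; proj₁; proj₂)
open import Data.Sign.Base as Sign using ()
open import Data.Sum.Base using (_⊎_; inj₁; inj₂)
open import Data.Vec.Base using (_∷_; []; tabulate)
import Data.Vec.Properties as Vecₚ
open import Function.Base using (_∘_)
open import Relation.Binary.Bundles using (StrictPartialOrder)
open import Relation.Binary.Definitions using (tri<; tri≈; tri>)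
open import Relation.Binary.PropositionalEquality as ≡ using (_≡_)
import Relation.Binary.Reasoning.StrictPartialOrder as StrictReasoning
open import Relation.Binary.Structures using (IsStrictTotalOrder)
open import Relation.Nullary using (¬_; Dec; yes; no; does)
open import Relation.Nullary.Decidable using (dec-true)

-- The supremum axiom produces a real number but no natural number, so the Archimedean property, and
-- with it the length L and the exponents of ρ, exist only up to double negation. Every final claim
-- is an inequality, which trichotomy makes stable, so all these choices are made while refuting its
-- negation. A logarithm of x is known only as a number y whose exponential series converges to x.
-- Upper bounds on e^y are easy for y ≥ 0, where all terms are nonnegative. The delicate fact is
-- that 1 ≤ e^y forces 0 ≤ y: for y < 0 the terms alternate in sign, and the claim is read off from
-- the Cauchy product of the series at -y and at y. The scores of an inner iteration are bounded
-- function by function. If g is the deficit 1 - f, the relative decreases of g sum to about 1 + ln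
-- (1/ε), usually by comparison with the integral of 1/g. Here a potential made of truncated linear
-- functions at geometric scales takes the place of the logarithm, so that the sum telescopes.

module OrderedField (ℛ : Reals) where

  open Reals ℛ hiding (zero)
  open RingProperties ring using (-‿involutive; -‿+-comm; -0#≈0#; -‿distribˡ-*; -‿distribʳ-*)

  open Mult′ semiring using () renaming (_×_ to _×′_; ×-homo-+ to ×′-homo-+; ×1-homo-* to ×′1-homo-*; 1+× to 1+×′)

  strictPartialOrder : StrictPartialOrder _ _ _
  strictPartialOrder = record
    { isStrictPartialOrder = IsStrictTotalOrder.isStrictPartialOrder isStrictTotalOrder }

  module Reasoning = StrictReasoning strictPartialOrder
  open Reasoning

  open IsStrictTotalOrder isStrictTotalOrder
    using () renaming (irrefl to <-irrefl)

  -- A ring solver with integer coefficients.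

  ⟦_⟧ᶻ : ℤ → Carrier
  ⟦ + n ⟧ᶻ      = n ×′ 1#
  ⟦ -[1+ n ] ⟧ᶻ = - (suc n ×′ 1#)

  private
    -‿⟦⟧ : ∀ i → ⟦ ℤ.- i ⟧ᶻ ≈ - ⟦ i ⟧ᶻ
    -‿⟦⟧ (+ zero)   = sym -0#≈0#
    -‿⟦⟧ (+ suc n)  = refl
    -‿⟦⟧ -[1+ n ]   = sym (-‿involutive _)

    cancel-1+ : ∀ x y → x - y ≈ (1# + x) - (1# + y)
    cancel-1+ x y = begin-equality
      x - y                   ≈⟨ +-identityˡ _ ⟨
      0# + (x - y)            ≈⟨ +-congʳ (-‿inverseʳ 1#) ⟨
      (1# - 1#) + (x - y)     ≈⟨ +-assoc _ _ _ ⟩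
      1# + (- 1# + (x - y))   ≈⟨ +-congˡ (+-comm _ _) ⟩
      1# + ((x - y) + - 1#)   ≈⟨ +-congˡ (+-assoc _ _ _) ⟩
      1# + (x + (- y + - 1#)) ≈⟨ +-congˡ (+-congˡ (+-comm _ _)) ⟩
      1# + (x + (- 1# + - y)) ≈⟨ +-assoc _ _ _ ⟨
      (1# + x) + (- 1# + - y) ≈⟨ +-congˡ (-‿+-comm _ _) ⟩
      (1# + x) - (1# + y)     ∎

    ⊖-homo : ∀ m n → ⟦ m ℤ.⊖ n ⟧ᶻ ≈ m ×′ 1# - n ×′ 1#
    ⊖-homo zero    zero    = sym (-‿inverseʳ 0#)
    ⊖-homo zero    (suc n) = sym (+-identityˡ _)
    ⊖-homo (suc m) zero    = sym (trans (+-congˡ -0#≈0#) (+-identityʳ _))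
    ⊖-homo (suc m) (suc n) = begin-equality
      ⟦ suc m ℤ.⊖ suc n ⟧ᶻ              ≡⟨ ≡.cong ⟦_⟧ᶻ (ℤₚ.[1+m]⊖[1+n]≡m⊖n m n) ⟩
      ⟦ m ℤ.⊖ n ⟧ᶻ                      ≈⟨ ⊖-homo m n ⟩
      m ×′ 1# - n ×′ 1#                 ≈⟨ cancel-1+ _ _ ⟩
      (1# + m ×′ 1#) - (1# + n ×′ 1#)   ≈⟨ +-cong (1+×′ m 1#) (-‿cong (1+×′ n 1#)) ⟨
      suc m ×′ 1# - suc n ×′ 1#         ∎

    +-⟦⟧ : ∀ i j → ⟦ i ℤ.+ j ⟧ᶻ ≈ ⟦ i ⟧ᶻ + ⟦ j ⟧ᶻ
    +-⟦⟧ (+ m)    (+ n)    = ×′-homo-+ 1# m n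
    +-⟦⟧ (+ m)    -[1+ n ] = ⊖-homo m (suc n)
    +-⟦⟧ -[1+ m ] (+ n)    = trans (⊖-homo n (suc m)) (+-comm _ _)
    +-⟦⟧ -[1+ m ] -[1+ n ] = begin-equality
      - (suc (suc (m ℕ.+ n)) ×′ 1#)            ≡⟨ ≡.cong (λ k → - (k ×′ 1#)) (ℕₚ.+-suc (suc m) n) ⟨
      - ((suc m ℕ.+ suc n) ×′ 1#)              ≈⟨ -‿cong (×′-homo-+ 1# (suc m) (suc n)) ⟩
      - (suc m ×′ 1# + suc n ×′ 1#)            ≈⟨ -‿+-comm _ _ ⟨
      - (suc m ×′ 1#) + - (suc n ×′ 1#)        ∎

    -◃ : ∀ n → ⟦ Sign.- ℤ.◃ n ⟧ᶻ ≈ - (n ×′ 1#)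
    -◃ zero    = sym -0#≈0#
    -◃ (suc n) = refl

    *-⟦⟧ : ∀ i j → ⟦ i ℤ.* j ⟧ᶻ ≈ ⟦ i ⟧ᶻ * ⟦ j ⟧ᶻ
    *-⟦⟧ (+ m)    (+ n)    = trans (reflexive (≡.cong ⟦_⟧ᶻ (ℤₚ.+◃n≡+n (m ℕ.* n)))) (×′1-homo-* m n)
    *-⟦⟧ (+ m)    -[1+ n ] = trans (-◃ (m ℕ.* suc n)) (trans (-‿cong (×′1-homo-* m (suc n))) (-‿distribʳ-* _ _))
    *-⟦⟧ -[1+ m ] (+ n)    = trans (-◃ (suc m ℕ.* n)) (trans (-‿cong (×′1-homo-* (suc m) n)) (-‿distribˡ-* _ _))
    *-⟦⟧ -[1+ m ] -[1+ n ] = begin-equality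
      (suc m ℕ.* suc n) ×′ 1#              ≈⟨ ×′1-homo-* (suc m) (suc n) ⟩
      (suc m ×′ 1#) * (suc n ×′ 1#)        ≈⟨ -‿involutive _ ⟨
      - - ((suc m ×′ 1#) * (suc n ×′ 1#))  ≈⟨ -‿cong (-‿distribʳ-* _ _) ⟩
      - ((suc m ×′ 1#) * - (suc n ×′ 1#))  ≈⟨ -‿distribˡ-* _ _ ⟩
      - (suc m ×′ 1#) * - (suc n ×′ 1#)    ∎

    ℤ-morphism : ℤ.+-*-rawRing -Raw-AlmostCommutative⟶ fromCommutativeRing commutativeRing
    ℤ-morphism = record
      { ⟦_⟧    = ⟦_⟧ᶻ
      ; +-homo = +-⟦⟧
      ; *-homo = *-⟦⟧
      ; -‿homo = -‿⟦⟧
      ; 0-homo = refl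
      ; 1-homo = refl
      }

    dec : ∀ i j → Maybe (⟦ i ⟧ᶻ ≈ ⟦ j ⟧ᶻ)
    dec i j with i ℤₚ.≟ j
    ... | yes i≡j = just (reflexive (≡.cong ⟦_⟧ᶻ i≡j))
    ... | no  _   = nothing

  open RingSolver ℤ.+-*-rawRing (fromCommutativeRing commutativeRing) ℤ-morphism dec
    using (solve; _:=_; _:+_; _:*_; _:-_; :-_; con; Polynomial) public

  -- With the optimised multiple `_×′_` these denote exactly `0#` and `1#`. Since `fromℕ 2` unfolds
  -- to `1# + (1# + 0#)`, polynomials below spell out numerals as `:1 :+ (:1 :+ :0)`.
  pattern :0 = con (+ 0)
  pattern :1 = con (+ 1)

  -- Order, inverses and natural numbers in an ordered field.

  ≤-refl : ∀ {x} → x ≤ x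
  ≤-refl = inj₂ refl

  ≤-reflexive : ∀ {x y} → x ≈ y → x ≤ y
  ≤-reflexive = inj₂

  ≤-trans : ∀ {x y z} → x ≤ y → y ≤ z → x ≤ z
  ≤-trans {x} {y} {z} x≤y y≤z = begin
    x ≤⟨ x≤y ⟩
    y ≤⟨ y≤z ⟩
    z ∎

  <⇒≤ : ∀ {x y} → x < y → x ≤ y
  <⇒≤ = inj₁

  <-≤-trans : ∀ {x y z} → x < y → y ≤ z → x < z
  <-≤-trans {x} {y} {z} x<y y≤z = begin-strict
    x <⟨ x<y ⟩
    y ≤⟨ y≤z ⟩
    z ∎

  ≤-<-trans : ∀ {x y z} → x ≤ y → y < z → x < z
  ≤-<-trans {x} {y} {z} x≤y y<z = begin-strict
    x ≤⟨ x≤y ⟩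
    y <⟨ y<z ⟩
    z ∎

  ≮⇒≥ : ∀ {x y} → ¬ (x < y) → y ≤ x
  ≮⇒≥ {x} {y} x≮y with compare x y
  ... | tri< x<y _ _ = ⊥-elim (x≮y x<y)
  ... | tri≈ _ x≈y _ = inj₂ (sym x≈y)
  ... | tri> _ _ y<x = inj₁ y<x

  ≤⇒≯ : ∀ {x y} → x ≤ y → ¬ (y < x)
  ≤⇒≯ x≤y y<x = <-irrefl refl (<-≤-trans y<x x≤y)

  ≰⇒> : ∀ {x y} → ¬ (x ≤ y) → y < x
  ≰⇒> {x} {y} x≰y with y <? x
  ... | yes y<x = y<x
  ... | no  y≮x = ⊥-elim (x≰y (≮⇒≥ y≮x))

  ≤-antisym : ∀ {x y} → x ≤ y → y ≤ x → x ≈ y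
  ≤-antisym (inj₂ x≈y) _   = x≈y
  ≤-antisym (inj₁ x<y) y≤x = ⊥-elim (≤⇒≯ y≤x x<y)

  _≤?_ : ∀ x y → Dec (x ≤ y)
  x ≤? y with y <? x
  ... | yes y<x = no λ x≤y → ≤⇒≯ x≤y y<x
  ... | no  y≮x = yes (≮⇒≥ y≮x)

  +-monoˡ-≤ : ∀ z {x y} → x ≤ y → x + z ≤ y + z
  +-monoˡ-≤ z (inj₁ x<y) = inj₁ (+-monoˡ-< z x<y)
  +-monoˡ-≤ z (inj₂ x≈y) = inj₂ (+-congʳ x≈y)

  +-monoʳ-≤ : ∀ z {x y} → x ≤ y → z + x ≤ z + y
  +-monoʳ-≤ z {x} {y} x≤y = begin
    z + x ≈⟨ +-comm z x ⟩
    x + z ≤⟨ +-monoˡ-≤ z x≤y ⟩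
    y + z ≈⟨ +-comm y z ⟩
    z + y ∎

  +-mono-≤ : ∀ {x y u v} → x ≤ y → u ≤ v → x + u ≤ y + v
  +-mono-≤ {y = y} {u} x≤y u≤v = ≤-trans (+-monoˡ-≤ u x≤y) (+-monoʳ-≤ y u≤v)

  -- The usual route to nonlinear inequalities below: name the slack `d`, show it nonnegative, and
  -- leave the identity to the ring solver.
  ≤-by : ∀ {x y} d → 0# ≤ d → y ≈ x + d → x ≤ y
  ≤-by {x} {y} d 0≤d y≈x+d = begin
    x      ≈⟨ +-identityʳ x ⟨
    x + 0# ≤⟨ +-monoʳ-≤ x 0≤d ⟩
    x + d  ≈⟨ y≈x+d ⟨
    y      ∎

  <-by : ∀ {x y} d → 0# < d → y ≈ x + d → x < y
  <-by {x} {y} d 0<d y≈x+d = begin-strict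
    x      ≈⟨ +-identityˡ x ⟨
    0# + x <⟨ +-monoˡ-< x 0<d ⟩
    d + x  ≈⟨ +-comm d x ⟩
    x + d  ≈⟨ y≈x+d ⟨
    y      ∎

  0≤y-x : ∀ {x y} → x ≤ y → 0# ≤ y - x
  0≤y-x {x} {y} x≤y = begin
    0#     ≈⟨ -‿inverseʳ x ⟨
    x - x  ≤⟨ +-monoˡ-≤ (- x) x≤y ⟩
    y - x  ∎

  0<y-x : ∀ {x y} → x < y → 0# < y - x
  0<y-x {x} {y} x<y = begin-strict
    0#     ≈⟨ -‿inverseʳ x ⟨
    x - x  <⟨ +-monoˡ-< (- x) x<y ⟩
    y - x  ∎

  +-nonNeg : ∀ {x y} → 0# ≤ x → 0# ≤ y → 0# ≤ x + y
  +-nonNeg {x} {y} 0≤x 0≤y = begin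
    0#      ≈⟨ +-identityʳ 0# ⟨
    0# + 0# ≤⟨ +-mono-≤ 0≤x 0≤y ⟩
    x + y   ∎

  *-nonNeg : ∀ {x y} → 0# ≤ x → 0# ≤ y → 0# ≤ x * y
  *-nonNeg (inj₁ 0<x) (inj₁ 0<y) = inj₁ (*-positive 0<x 0<y)
  *-nonNeg {x} {y} (inj₁ _) (inj₂ 0≈y) = inj₂ (trans (sym (zeroʳ x)) (*-congˡ 0≈y))
  *-nonNeg {x} {y} (inj₂ 0≈x) _ = inj₂ (trans (sym (zeroˡ y)) (*-congʳ 0≈x))

  *-monoʳ-≤ : ∀ {z x y} → 0# ≤ z → x ≤ y → z * x ≤ z * y
  *-monoʳ-≤ {z} {x} {y} 0≤z x≤y = ≤-by (z * (y - x)) (*-nonNeg 0≤z (0≤y-x x≤y))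
    (solve 3 (λ z x y → z :* y := z :* x :+ z :* (y :- x)) refl z x y)

  *-monoˡ-≤ : ∀ {z x y} → 0# ≤ z → x ≤ y → x * z ≤ y * z
  *-monoˡ-≤ {z} {x} {y} 0≤z x≤y = begin
    x * z ≈⟨ *-comm x z ⟩
    z * x ≤⟨ *-monoʳ-≤ 0≤z x≤y ⟩
    z * y ≈⟨ *-comm z y ⟩
    y * z ∎

  *-mono-≤ : ∀ {x y u v} → 0# ≤ u → 0# ≤ y → x ≤ y → u ≤ v → x * u ≤ y * v
  *-mono-≤ 0≤u 0≤y x≤y u≤v = ≤-trans (*-monoˡ-≤ 0≤u x≤y) (*-monoʳ-≤ 0≤y u≤v)

  *-monoʳ-< : ∀ {z x y} → 0# < z → x < y → z * x < z * y
  *-monoʳ-< {z} {x} {y} 0<z x<y = <-by (z * (y - x)) (*-positive 0<z (0<y-x x<y))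
    (solve 3 (λ z x y → z :* y := z :* x :+ z :* (y :- x)) refl z x y)

  *-cancelˡ-≤ : ∀ {z x y} → 0# < z → z * x ≤ z * y → x ≤ y
  *-cancelˡ-≤ 0<z zx≤zy = ≮⇒≥ λ y<x → ≤⇒≯ zx≤zy (*-monoʳ-< 0<z y<x)

  *-cancelˡ-< : ∀ {z x y} → 0# ≤ z → z * x < z * y → x < y
  *-cancelˡ-< {z} {x} {y} 0≤z zx<zy with x <? y
  ... | yes x<y = x<y
  ... | no  x≮y = ⊥-elim (≤⇒≯ (*-monoʳ-≤ 0≤z (≮⇒≥ x≮y)) zx<zy)

  >⇒≉ : ∀ {x} → 0# < x → ¬ (x ≈ 0#)
  >⇒≉ 0<x x≈0 = <-irrefl (sym x≈0) 0<x

  x*x⁻¹≈1 : ∀ {x} → 0# < x → x * x ⁻¹ ≈ 1#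
  x*x⁻¹≈1 {x} 0<x = ⁻¹-inverse x (>⇒≉ 0<x)

  0≤1 : 0# ≤ 1#
  0≤1 = inj₁ 0<1

  ⁻¹-positive : ∀ {x} → 0# < x → 0# < x ⁻¹
  ⁻¹-positive {x} 0<x = *-cancelˡ-< (<⇒≤ 0<x) (begin-strict
    x * 0#   ≈⟨ zeroʳ x ⟩
    0#       <⟨ 0<1 ⟩
    1#       ≈⟨ x*x⁻¹≈1 0<x ⟨
    x * x ⁻¹ ∎)

  /-nonNeg : ∀ {x y} → 0# ≤ x → 0# < y → 0# ≤ x / y
  /-nonNeg 0≤x 0<y = *-nonNeg 0≤x (<⇒≤ (⁻¹-positive 0<y))

  y*[x/y]≈x : ∀ {x y} → 0# < y → y * (x / y) ≈ x
  y*[x/y]≈x {x} {y} 0<y = begin-equality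
    y * (x * y ⁻¹)  ≈⟨ solve 3 (λ x y z → y :* (x :* z) := x :* (y :* z)) refl x y (y ⁻¹) ⟩
    x * (y * y ⁻¹)  ≈⟨ *-congˡ (x*x⁻¹≈1 0<y) ⟩
    x * 1#          ≈⟨ *-identityʳ x ⟩
    x               ∎

  ≤-/ : ∀ {x y z} → 0# < y → y * z ≤ x → z ≤ x / y
  ≤-/ {x} {y} {z} 0<y yz≤x = *-cancelˡ-≤ 0<y (≤-trans yz≤x (≤-reflexive (sym (y*[x/y]≈x 0<y))))

  /-≤ : ∀ {x y z} → 0# < y → x ≤ y * z → x / y ≤ z
  /-≤ {x} {y} {z} 0<y x≤yz = *-cancelˡ-≤ 0<y (≤-trans (≤-reflexive (y*[x/y]≈x 0<y)) x≤yz)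

  +-pos-nonNeg : ∀ {x y} → 0# < x → 0# ≤ y → 0# < x + y
  +-pos-nonNeg {x} {y} 0<x 0≤y = <-≤-trans 0<x (≤-by y 0≤y refl)

  open Mult semiring using (×-homo-+; ×1-homo-*)

  fromℕ-+ : ∀ m n → fromℕ (m ℕ.+ n) ≈ fromℕ m + fromℕ n
  fromℕ-+ = ×-homo-+ 1#

  fromℕ-* : ∀ m n → fromℕ (m ℕ.* n) ≈ fromℕ m * fromℕ n
  fromℕ-* = ×1-homo-*

  fromℕ-^ : ∀ m n → fromℕ (m ℕ.^ n) ≈ fromℕ m ^ n
  fromℕ-^ m zero    = +-identityʳ 1#
  fromℕ-^ m (suc n) = trans (fromℕ-* m (m ℕ.^ n)) (*-congˡ (fromℕ-^ m n))

  fromℕ-nonNeg : ∀ n → 0# ≤ fromℕ n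
  fromℕ-nonNeg zero    = ≤-refl
  fromℕ-nonNeg (suc n) = +-nonNeg 0≤1 (fromℕ-nonNeg n)

  fromℕ-suc-pos : ∀ n → 0# < fromℕ (suc n)
  fromℕ-suc-pos n = +-pos-nonNeg 0<1 (fromℕ-nonNeg n)

  fromℕ-pos : ∀ {n} → 1 ℕ.≤ n → 0# < fromℕ n
  fromℕ-pos {suc n} _ = fromℕ-suc-pos n

  fromℕ-mono-≤ : ∀ {m n} → m ℕ.≤ n → fromℕ m ≤ fromℕ n
  fromℕ-mono-≤ {m} {n} m≤n = ≤-by (fromℕ (n ℕ.∸ m)) (fromℕ-nonNeg (n ℕ.∸ m))
    (trans (reflexive (≡.cong fromℕ (≡.sym (ℕₚ.m+[n∸m]≡n m≤n)))) (fromℕ-+ m (n ℕ.∸ m)))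

  fromℕ-cancel-< : ∀ {m n} → fromℕ m < fromℕ n → m ℕ.< n
  fromℕ-cancel-< {m} {n} p = ℕₚ.≰⇒> λ n≤m → ≤⇒≯ (fromℕ-mono-≤ n≤m) p

  fromℕ-mono-< : ∀ {m n} → m ℕ.< n → fromℕ m < fromℕ n
  fromℕ-mono-< {m} m<n = <-≤-trans (<-by 1# 0<1 (+-comm 1# (fromℕ m))) (fromℕ-mono-≤ m<n)

  ^-pos : ∀ {x} → 0# < x → ∀ n → 0# < x ^ n
  ^-pos 0<x zero    = 0<1
  ^-pos 0<x (suc n) = *-positive 0<x (^-pos 0<x n)

  ^-nonNeg : ∀ {x} → 0# ≤ x → ∀ n → 0# ≤ x ^ n
  ^-nonNeg 0≤x zero    = 0≤1
  ^-nonNeg 0≤x (suc n) = *-nonNeg 0≤x (^-nonNeg 0≤x n)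

  ^-mono-≤ : ∀ {x y} → 0# ≤ x → x ≤ y → ∀ n → x ^ n ≤ y ^ n
  ^-mono-≤ 0≤x x≤y zero    = ≤-refl
  ^-mono-≤ 0≤x x≤y (suc n) = *-mono-≤ (^-nonNeg 0≤x n) (≤-trans 0≤x x≤y) x≤y (^-mono-≤ 0≤x x≤y n)

  -- Double negation cannot be removed: the supremum axiom yields no witness.
  archimedean : ∀ x {b} → 0# < b → ¬ ¬ (∃[ n ] x < fromℕ n * b)
  archimedean x {b} 0<b none = ≤⇒≯ (least (s - b) s-b-bound) (<-by b 0<b s≈)
    where
    Multiple : Carrier → Set
    Multiple z = ∃[ n ] z ≈ fromℕ n * b

    sup : ∃[ s ] UpperBound Multiple s × (∀ c → UpperBound Multiple c → s ≤ c)
    sup = supremum Multiple (0# , 0 , sym (zeroˡ b))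
      (x , λ { z (n , z≈nb) → ≤-trans (≤-reflexive z≈nb) (≮⇒≥ λ x<nb → none (n , x<nb)) })

    s : Carrier
    s = proj₁ sup

    least : ∀ c → UpperBound Multiple c → s ≤ c
    least = proj₂ (proj₂ sup)

    s≈ : s ≈ (s - b) + b
    s≈ = solve 2 (λ s b → s := (s :- b) :+ b) refl s b

    s-b-bound : UpperBound Multiple (s - b)
    s-b-bound z (n , z≈nb) = begin
      z                  ≈⟨ z≈nb ⟩
      fromℕ n * b        ≈⟨ solve 2 (λ m b → m :* b := (:1 :+ m) :* b :- b) refl (fromℕ n) b ⟩
      fromℕ (suc n) * b - b  ≤⟨ +-monoˡ-≤ (- b) (proj₁ (proj₂ sup) _ (suc n , refl)) ⟩
      s - b              ∎

  sum-mono : ∀ {n} {f g : Fin n → Carrier} → (∀ i → f i ≤ g i) → sum f ≤ sum g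
  sum-mono {zero}  f≤g = ≤-refl
  sum-mono {suc n} f≤g = +-mono-≤ (f≤g fzero) (sum-mono λ i → f≤g (fsuc i))

-- Bounds on the exponential series and on logarithms.

module Logarithm (ℛ : Reals) where

  open Reals ℛ hiding (zero)
  open OrderedField ℛ
  open Reasoning

  ≈-cancelˡ : ∀ {z x y} → 0# < z → z * x ≈ z * y → x ≈ y
  ≈-cancelˡ 0<z zx≈zy = ≤-antisym (*-cancelˡ-≤ 0<z (inj₂ zx≈zy)) (*-cancelˡ-≤ 0<z (inj₂ (sym zx≈zy)))

  -- A discrete intermediate value principle, from which a window, a power of ρ, a scale and the
  -- length L are obtained. It asks for a crossing only, since `P` need not be monotone.
  first-step : {P : ℕ → Set} → (∀ n → Dec (P n)) → ¬ P 0 → ∀ N → P N →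
               ∃[ n ] suc n ℕ.≤ N × ¬ P n × P (suc n)
  first-step P? ¬P0 zero    PN = ⊥-elim (¬P0 PN)
  first-step P? ¬P0 (suc N) PN with P? N
  ... | no ¬PN  = N , ℕₚ.≤-refl , ¬PN , PN
  ... | yes PN′ with first-step P? ¬P0 N PN′
  ...   | n , n<N , rest = n , ℕₚ.m≤n⇒m≤1+n n<N , rest

  -- Sequences live on all of ℕ, so that one sequence can be cut at different lengths and shifted by
  -- `suc`. `expSeries y N` is `Σ< N (τ y)` by definition.
  Σ< : ℕ → (ℕ → Carrier) → Carrier
  Σ< n u = sum {n} λ i → u (toℕ i)

  Σ<-last : ∀ n u → Σ< (suc n) u ≈ Σ< n u + u n
  Σ<-last zero    u = +-comm _ _
  Σ<-last (suc n) u = trans (+-congˡ (Σ<-last n (u ∘ suc))) (sym (+-assoc _ _ _))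

  Σ<-nonNeg : ∀ n {u} → (∀ i → 0# ≤ u i) → 0# ≤ Σ< n u
  Σ<-nonNeg zero    0≤u = ≤-refl
  Σ<-nonNeg (suc n) 0≤u = +-nonNeg (0≤u 0) (Σ<-nonNeg n (0≤u ∘ suc))

  Σ<-mono : ∀ n {u v} → (∀ i → u i ≤ v i) → Σ< n u ≤ Σ< n v
  Σ<-mono n u≤v = sum-mono {n} λ i → u≤v (toℕ i)

  Σ<-grow : ∀ n {u} → (∀ i → 0# ≤ u i) → Σ< n u ≤ Σ< (suc n) u
  Σ<-grow n {u} 0≤u = ≤-by (u n) (0≤u n) (Σ<-last n u)

  τ : Carrier → ℕ → Carrier
  τ y i = y ^ i / fromℕ (i !)

  !-pos : ∀ i → 0# < fromℕ (i !)
  !-pos i = fromℕ-pos (ℕₚ.1≤n! i)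

  -- The division-free recurrence by which `τ-step` and `conv-exp` clear the factorials.
  τ-rec : ∀ y i → fromℕ (suc i) * τ y (suc i) ≈ y * τ y i
  τ-rec y i = ≈-cancelˡ (!-pos i) (begin-equality
    f * (c * (y * p * g ⁻¹))
      ≈⟨ solve 5 (λ f c y p g′ → f :* (c :* (y :* p :* g′)) := y :* p :* ((c :* f) :* g′)) refl f c y p (g ⁻¹) ⟩
    y * p * ((c * f) * g ⁻¹)  ≈⟨ *-congˡ (*-congʳ (fromℕ-* (suc i) (i !))) ⟨
    y * p * (g * g ⁻¹)        ≈⟨ *-congˡ (x*x⁻¹≈1 (!-pos (suc i))) ⟩
    y * p * 1#                ≈⟨ *-congˡ (x*x⁻¹≈1 (!-pos i)) ⟨
    y * p * (f * f ⁻¹)        ≈⟨ solve 4 (λ f f′ y p → y :* p :* (f :* f′) := f :* (y :* (p :* f′))) refl f (f ⁻¹) y p ⟩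
    f * (y * (p * f ⁻¹))      ∎)
    where
    f = fromℕ (i !)
    g = fromℕ (suc i !)
    c = fromℕ (suc i)
    p = y ^ i

  τ-0 : ∀ y → τ y 0 ≈ 1#
  τ-0 y = trans (*-congʳ (sym (+-identityʳ 1#))) (x*x⁻¹≈1 (!-pos 0))

  τ-1 : ∀ y → τ y 1 ≈ y
  τ-1 y = begin-equality
    τ y 1             ≈⟨ *-identityˡ _ ⟨
    1# * τ y 1        ≈⟨ *-congʳ (+-identityʳ 1#) ⟨
    fromℕ 1 * τ y 1   ≈⟨ τ-rec y 0 ⟩
    y * τ y 0         ≈⟨ *-congˡ (τ-0 y) ⟩
    y * 1#            ≈⟨ *-identityʳ y ⟩
    y                 ∎

  τ-mono : ∀ {y z} → 0# ≤ y → y ≤ z → ∀ i → τ y i ≤ τ z i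
  τ-mono 0≤y y≤z i = *-monoˡ-≤ (<⇒≤ (⁻¹-positive (!-pos i))) (^-mono-≤ 0≤y y≤z i)

  τ-nonNeg : ∀ {y} → 0# ≤ y → ∀ i → 0# ≤ τ y i
  τ-nonNeg 0≤y i = /-nonNeg (^-nonNeg 0≤y i) (!-pos i)

  -- A mean value inequality: the derivative of τ (suc i) is τ i.
  τ-step : ∀ {y h} → 0# ≤ y → 0# ≤ h → ∀ i → τ (y + h) (suc i) ≤ τ y (suc i) + h * τ (y + h) i
  τ-step {y} {h} 0≤y 0≤h zero = *-cancelˡ-≤ (fromℕ-suc-pos 0) (≤-reflexive (begin-equality
    fromℕ 1 * τ (y + h) 1                      ≈⟨ τ-rec (y + h) 0 ⟩
    (y + h) * t
      ≈⟨ solve 3 (λ y h t → (y :+ h) :* t := y :* t :+ (:1 :+ :0) :* (h :* t)) refl y h t ⟩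
    y * t + fromℕ 1 * (h * t)                  ≈⟨ +-congʳ (τ-rec y 0) ⟨
    fromℕ 1 * τ y 1 + fromℕ 1 * (h * t)        ≈⟨ distribˡ (fromℕ 1) (τ y 1) (h * t) ⟨
    fromℕ 1 * (τ y 1 + h * t)                  ∎))
    where t = τ y 0
  τ-step {y} {h} 0≤y 0≤h (suc i) = *-cancelˡ-≤ (fromℕ-suc-pos (suc i)) (begin
    c * τ (y + h) (suc (suc i))                ≈⟨ τ-rec (y + h) (suc i) ⟩
    (y + h) * T                                ≈⟨ distribʳ T y h ⟩
    y * T + h * T                              ≤⟨ +-monoˡ-≤ (h * T) (*-monoʳ-≤ 0≤y (τ-step 0≤y 0≤h i)) ⟩
    y * (τ y (suc i) + h * T′) + h * T         ≤⟨ ≤-by (h * (h * T′)) (*-nonNeg 0≤h (*-nonNeg 0≤h 0≤T′))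
        (solve 5 (λ y h t T T′ → y :* t :+ h :* ((y :+ h) :* T′) :+ h :* T :=
            (y :* (t :+ h :* T′) :+ h :* T) :+ h :* (h :* T′)) refl y h (τ y (suc i)) T T′) ⟩
    y * τ y (suc i) + h * ((y + h) * T′) + h * T  ≈⟨ +-congʳ (+-cong (τ-rec y (suc i)) (*-congˡ (τ-rec (y + h) i))) ⟨
    c * τ y (suc (suc i)) + h * (c′ * T) + h * T
      ≈⟨ solve 4 (λ c′ h T t → (:1 :+ c′) :* t :+ h :* (c′ :* T) :+ h :* T :=
          (:1 :+ c′) :* (t :+ h :* T)) refl c′ h T (τ y (suc (suc i))) ⟩
    c * (τ y (suc (suc i)) + h * T)            ∎)
    where
    c = fromℕ (suc (suc i))
    c′ = fromℕ (suc i)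
    T = τ (y + h) (suc i)
    T′ = τ (y + h) i
    0≤T′ : 0# ≤ T′
    0≤T′ = τ-nonNeg (+-nonNeg 0≤y 0≤h) i

  -- Summing `τ-step` over the terms after the zeroth leaves one term fewer on the right; the
  -- missing term is nonnegative and may be added back.
  exp-step : ∀ N {y h} → 0# ≤ y → 0# ≤ h →
             expSeries (y + h) N ≤ expSeries y N + h * expSeries (y + h) N
  exp-step zero {y} {h} 0≤y 0≤h = ≤-reflexive (solve 1 (λ h → :0 := :0 :+ h :* :0) refl h)
  exp-step (suc N) {y} {h} 0≤y 0≤h = begin
    τ y 0 + Σ< N (τ (y + h) ∘ suc)
      ≤⟨ +-monoʳ-≤ (τ y 0) (Σ<-mono N (τ-step 0≤y 0≤h)) ⟩
    τ y 0 + Σ< N (λ i → τ y (suc i) + h * τ (y + h) i)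
      ≈⟨ +-congˡ (Σ<-lin N (τ y ∘ suc) h (τ (y + h))) ⟩
    τ y 0 + (Σ< N (τ y ∘ suc) + h * expSeries (y + h) N)
      ≈⟨ +-assoc _ _ _ ⟨
    expSeries y (suc N) + h * expSeries (y + h) N
      ≤⟨ +-monoʳ-≤ _ (*-monoʳ-≤ 0≤h (Σ<-grow N (τ-nonNeg (+-nonNeg 0≤y 0≤h)))) ⟩
    expSeries y (suc N) + h * expSeries (y + h) (suc N) ∎
    where
    Σ<-lin : ∀ n u h v → Σ< n (λ i → u i + h * v i) ≈ Σ< n u + h * Σ< n v
    Σ<-lin zero    u h v = solve 1 (λ h → :0 := :0 :+ h :* :0) refl h
    Σ<-lin (suc n) u h v = trans (+-congˡ (Σ<-lin n (u ∘ suc) h (v ∘ suc)))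
      (solve 5 (λ a h b c d → a :+ h :* b :+ (c :+ h :* d) := a :+ c :+ h :* (b :+ d)) refl (u 0) h (v 0) _ _)

  ¼ : Carrier
  ¼ = fromℕ 4 ⁻¹

  0<¼ : 0# < ¼
  0<¼ = ⁻¹-positive (fromℕ-suc-pos 3)

  4*¼≈1 : fromℕ 4 * ¼ ≈ 1#
  4*¼≈1 = x*x⁻¹≈1 (fromℕ-suc-pos 3)

  -- 4/3 is 1 / (1 - ¼): by `exp-step` with h = ¼, a step of ¼ multiplies the exponential by at most
  -- this factor. It is also the rate at which inner iterations thin out the heavy agents, and it
  -- stays below 3/2, the rate of the thresholds.
  ρ : Carrier
  ρ = fromℕ 4 / fromℕ 3

  3*ρ≈4 : fromℕ 3 * ρ ≈ fromℕ 4
  3*ρ≈4 = y*[x/y]≈x (fromℕ-suc-pos 2)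

  0<ρ : 0# < ρ
  0<ρ = *-positive (fromℕ-suc-pos 3) (⁻¹-positive (fromℕ-suc-pos 2))

  ⅓ : Carrier
  ⅓ = fromℕ 3 ⁻¹

  0<⅓ : 0# < ⅓
  0<⅓ = ⁻¹-positive (fromℕ-suc-pos 2)

  ρ≈1+⅓ : ρ ≈ 1# + ⅓
  ρ≈1+⅓ = begin-equality
    (1# + fromℕ 3) * ⅓   ≈⟨ distribʳ ⅓ 1# (fromℕ 3) ⟩
    1# * ⅓ + fromℕ 3 * ⅓ ≈⟨ +-cong (*-identityˡ ⅓) (x*x⁻¹≈1 (fromℕ-suc-pos 2)) ⟩
    ⅓ + 1#               ≈⟨ +-comm ⅓ 1# ⟩
    1# + ⅓               ∎

  -- Together with `archimedean` this makes some power of ρ exceed any given number.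
  ρ^-bernoulli : ∀ n → 1# + fromℕ n * ⅓ ≤ ρ ^ n
  ρ^-bernoulli zero    = ≤-reflexive (trans (+-congˡ (zeroˡ ⅓)) (+-identityʳ 1#))
  ρ^-bernoulli (suc n) = begin
    1# + (1# + fromℕ n) * ⅓             ≤⟨ ≤-by (fromℕ n * ⅓ * ⅓) (*-nonNeg (*-nonNeg (fromℕ-nonNeg n) (<⇒≤ 0<⅓)) (<⇒≤ 0<⅓))
        (solve 2 (λ n t → (:1 :+ t) :* (:1 :+ n :* t) := :1 :+ (:1 :+ n) :* t :+ n :* t :* t) refl (fromℕ n) ⅓) ⟩
    (1# + ⅓) * (1# + fromℕ n * ⅓)       ≈⟨ *-congʳ ρ≈1+⅓ ⟨
    ρ * (1# + fromℕ n * ⅓)              ≤⟨ *-monoʳ-≤ (<⇒≤ 0<ρ) (ρ^-bernoulli n) ⟩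
    ρ * ρ ^ n                           ∎

  exp-quarter : ∀ N {y} → 0# ≤ y → expSeries (y + ¼) N ≤ ρ * expSeries y N
  exp-quarter N {y} 0≤y = *-cancelˡ-≤ (fromℕ-suc-pos 2) (begin
    fromℕ 3 * e′
      ≤⟨ ≤-by (fromℕ 4 * (e + ¼ * e′ - e′)) (*-nonNeg (fromℕ-nonNeg 4) (0≤y-x (exp-step N 0≤y (<⇒≤ 0<¼)))) eq ⟩
    fromℕ 4 * e                    ≈⟨ *-congʳ 3*ρ≈4 ⟨
    fromℕ 3 * ρ * e                ≈⟨ *-assoc _ _ _ ⟩
    fromℕ 3 * (ρ * e)              ∎)
    where
    e = expSeries y N
    e′ = expSeries (y + ¼) N
    eq : fromℕ 4 * e ≈ fromℕ 3 * e′ + fromℕ 4 * (e + ¼ * e′ - e′)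
    eq = begin-equality
      fromℕ 4 * e
        ≈⟨ solve 4 (λ f e e′ q → f :* e := f :* (e :+ q :* e′ :- e′) :+ (f :* e′ :- f :* q :* e′)) refl (fromℕ 4) e e′ ¼ ⟩
      fromℕ 4 * (e + ¼ * e′ - e′) + (fromℕ 4 * e′ - fromℕ 4 * ¼ * e′) ≈⟨ +-congˡ (+-congˡ (-‿cong (*-congʳ 4*¼≈1))) ⟩
      fromℕ 4 * (e + ¼ * e′ - e′) + (fromℕ 4 * e′ - 1# * e′)
        ≈⟨ solve 3 (λ s f e′ → s :+ ((:1 :+ f) :* e′ :- :1 :* e′) :=
            f :* e′ :+ s) refl (fromℕ 4 * (e + ¼ * e′ - e′)) (fromℕ 3) e′ ⟩
      fromℕ 3 * e′ + fromℕ 4 * (e + ¼ * e′ - e′)          ∎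

  exp-mono : ∀ N {y z} → 0# ≤ y → y ≤ z → expSeries y N ≤ expSeries z N
  exp-mono N 0≤y y≤z = Σ<-mono N (τ-mono 0≤y y≤z)

  n¼-nonNeg : ∀ n → 0# ≤ fromℕ n * ¼
  n¼-nonNeg n = *-nonNeg (fromℕ-nonNeg n) (<⇒≤ 0<¼)

  exp-n¼ : ∀ N n → expSeries (fromℕ n * ¼) N ≤ ρ ^ n
  exp-n¼ zero zero = 0≤1
  exp-n¼ (suc N) zero = ≤-reflexive (trans (+-cong (τ-0 (0# * ¼)) (zeros N (λ i → τ (0# * ¼) (suc i)) vanish)) (+-identityʳ 1#))
    where
    zeros : ∀ n (u : ℕ → Carrier) → (∀ i → u i ≈ 0#) → Σ< n u ≈ 0#
    zeros zero    u u≈0 = refl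
    zeros (suc n) u u≈0 = trans (+-cong (u≈0 0) (zeros n (u ∘ suc) (u≈0 ∘ suc))) (+-identityʳ 0#)
    vanish : ∀ i → τ (0# * ¼) (suc i) ≈ 0#
    vanish i = solve 3 (λ q p f → :0 :* q :* p :* f := :0) refl ¼ ((0# * ¼) ^ i) (fromℕ (suc i !) ⁻¹)
  exp-n¼ N (suc n) = begin
    expSeries (fromℕ (suc n) * ¼) N
      ≤⟨ exp-mono N (n¼-nonNeg (suc n)) (≤-reflexive (solve 2 (λ n q → (:1 :+ n) :* q := n :* q :+ q) refl (fromℕ n) ¼)) ⟩
    expSeries (fromℕ n * ¼ + ¼) N    ≤⟨ exp-quarter N (n¼-nonNeg n) ⟩
    ρ * expSeries (fromℕ n * ¼) N    ≤⟨ *-monoʳ-≤ (<⇒≤ 0<ρ) (exp-n¼ N n) ⟩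
    ρ * ρ ^ n                        ∎

  exp-≤ : ∀ N n {y} → 0# ≤ y → y ≤ fromℕ n * ¼ → expSeries y N ≤ ρ ^ n
  exp-≤ N n 0≤y y≤n¼ = ≤-trans (exp-mono N 0≤y y≤n¼) (exp-n¼ N n)

  limit-≤ : ∀ {s x b} → s ConvergesTo x → (∀ M → s M ≤ b) → x ≤ b
  limit-≤ {s} {x} {b} s→x s≤b = ≮⇒≥ λ b<x →
    let M , near = s→x (x - b) (0<y-x b<x)
        b<sM = ≤-<-trans (≤-reflexive (solve 2 (λ x b → b := x :- (x :- b)) refl x b)) (proj₁ (near M ℕₚ.≤-refl))
    in ≤⇒≯ (s≤b M) b<sM

  -- Cauchy products, and the sign of a logarithm.

  conv : (ℕ → Carrier) → (ℕ → Carrier) → ℕ → Carrier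
  conv u v zero    = u 0 * v 0
  conv u v (suc n) = u 0 * v (suc n) + conv (u ∘ suc) v n

  conv-cong : ∀ n {u u′ v v′} → (∀ i → u i ≈ u′ i) → (∀ i → v i ≈ v′ i) → conv u v n ≈ conv u′ v′ n
  conv-cong zero    u≈ v≈ = *-cong (u≈ 0) (v≈ 0)
  conv-cong (suc n) u≈ v≈ = +-cong (*-cong (u≈ 0) (v≈ (suc n))) (conv-cong n (u≈ ∘ suc) v≈)

  conv-last : ∀ n u v → conv u v (suc n) ≈ conv u (v ∘ suc) n + u (suc n) * v 0
  conv-last zero    u v = refl
  conv-last (suc n) u v = trans (+-congˡ (conv-last n (u ∘ suc) v)) (sym (+-assoc _ _ _))

  conv-+ʳ : ∀ n u v v′ → conv u (λ i → v i + v′ i) n ≈ conv u v n + conv u v′ n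
  conv-+ʳ zero    u v v′ = distribˡ _ _ _
  conv-+ʳ (suc n) u v v′ = trans (+-congˡ (conv-+ʳ n (u ∘ suc) v v′))
    (solve 5 (λ a b c d e → a :* (b :+ c) :+ (d :+ e) := (a :* b :+ d) :+ (a :* c :+ e)) refl (u 0) (v (suc n)) (v′ (suc n)) _ _)

  conv-*ˡ : ∀ n a u v → conv (λ i → a * u i) v n ≈ a * conv u v n
  conv-*ˡ zero    a u v = *-assoc _ _ _
  conv-*ˡ (suc n) a u v = trans (+-congˡ (conv-*ˡ n a (u ∘ suc) v))
    (solve 4 (λ a b c d → a :* b :* c :+ a :* d := a :* (b :* c :+ d)) refl a (u 0) (v (suc n)) _)

  conv-*ʳ : ∀ n a u v → conv u (λ i → a * v i) n ≈ a * conv u v n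
  conv-*ʳ zero    a u v = solve 3 (λ a b c → b :* (a :* c) := a :* (b :* c)) refl a (u 0) (v 0)
  conv-*ʳ (suc n) a u v = trans (+-congˡ (conv-*ʳ n a (u ∘ suc) v))
    (solve 4 (λ a b c d → b :* (a :* c) :+ a :* d := a :* (b :* c :+ d)) refl a (u 0) (v (suc n)) _)

  -- The product rule for the Euler operator on power series.
  conv-leibniz : ∀ n k u v → (k + fromℕ n) * conv u v n ≈
    conv (λ i → (k + fromℕ i) * u i) v n + conv u (λ i → fromℕ i * v i) n
  conv-leibniz zero    k u v =
    solve 3 (λ k a b → (k :+ :0) :* (a :* b) := (k :+ :0) :* a :* b :+ a :* (:0 :* b)) refl k (u 0) (v 0)
  conv-leibniz (suc n) k u v = begin-equality
    (k + fromℕ (suc n)) * (u 0 * v (suc n) + r)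
      ≈⟨ solve 5 (λ k n a b r → (k :+ (:1 :+ n)) :* (a :* b :+ r) :=
          (k :+ :0) :* a :* b :+ a :* ((:1 :+ n) :* b) :+ ((k :+ :1) :+ n) :* r) refl k (fromℕ n) (u 0) (v (suc n)) r ⟩
    (k + 0#) * u 0 * v (suc n) + u 0 * (fromℕ (suc n) * v (suc n)) + ((k + 1#) + fromℕ n) * r
      ≈⟨ +-congˡ (conv-leibniz n (k + 1#) (u ∘ suc) v) ⟩
    (k + 0#) * u 0 * v (suc n) + u 0 * (fromℕ (suc n) * v (suc n)) +
      (conv (λ i → ((k + 1#) + fromℕ i) * u (suc i)) v n + conv (u ∘ suc) (λ i → fromℕ i * v i) n)
      ≈⟨ +-congˡ (+-congʳ (conv-cong n (λ i → *-congʳ (+-assoc k 1# (fromℕ i))) (λ i → refl))) ⟩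
    (k + 0#) * u 0 * v (suc n) + u 0 * (fromℕ (suc n) * v (suc n)) +
      (conv (λ i → (k + fromℕ (suc i)) * u (suc i)) v n + conv (u ∘ suc) (λ i → fromℕ i * v i) n)
      ≈⟨ solve 4 (λ a b c d → a :+ b :+ (c :+ d) :=
          (a :+ c) :+ (b :+ d)) refl ((k + 0#) * u 0 * v (suc n)) (u 0 * (fromℕ (suc n) * v (suc n))) _ _ ⟩
    conv (λ i → (k + fromℕ i) * u i) v (suc n) + conv u (λ i → fromℕ i * v i) (suc n) ∎
    where r = conv (u ∘ suc) v n

  -- e^a e^b = 1 as formal series when a + b = 0.
  conv-exp : ∀ {a b} → a + b ≈ 0# → ∀ n → conv (τ a) (τ b) (suc n) ≈ 0#
  conv-exp {a} {b} a+b≈0 n = ≈-cancelˡ (fromℕ-suc-pos n) (begin-equality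
    fromℕ (suc n) * conv u v (suc n)          ≈⟨ *-congʳ (+-identityˡ _) ⟨
    (0# + fromℕ (suc n)) * conv u v (suc n)   ≈⟨ conv-leibniz (suc n) 0# u v ⟩
    conv (λ i → (0# + fromℕ i) * u i) v (suc n) + conv u (λ i → fromℕ i * v i) (suc n)
      ≈⟨ +-cong left right ⟩
    a * c + b * c                             ≈⟨ distribʳ c a b ⟨
    (a + b) * c                               ≈⟨ *-congʳ a+b≈0 ⟩
    0# * c                                    ≈⟨ zeroˡ c ⟩
    0#                                        ≈⟨ zeroʳ _ ⟨
    fromℕ (suc n) * 0#                        ∎)
    where
    u = τ a
    v = τ b
    c = conv u v n
    left : conv (λ i → (0# + fromℕ i) * u i) v (suc n) ≈ a * c
    left = begin-equality
      (0# + 0#) * u 0 * v (suc n) + conv (λ i → (0# + fromℕ (suc i)) * u (suc i)) v n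
        ≈⟨ solve 3 (λ p q r → (:0 :+ :0) :* p :* q :+ r := r) refl (u 0) (v (suc n)) _ ⟩
      conv (λ i → (0# + fromℕ (suc i)) * u (suc i)) v n
        ≈⟨ conv-cong n (λ i → trans (*-congʳ (+-identityˡ _)) (τ-rec a i)) (λ i → refl) ⟩
      conv (λ i → a * u i) v n  ≈⟨ conv-*ˡ n a u v ⟩
      a * c ∎
    right : conv u (λ i → fromℕ i * v i) (suc n) ≈ b * c
    right = begin-equality
      conv u (λ i → fromℕ i * v i) (suc n)
        ≈⟨ conv-last n u (λ i → fromℕ i * v i) ⟩
      conv u (λ i → fromℕ (suc i) * v (suc i)) n + u (suc n) * (0# * v 0)
        ≈⟨ solve 3 (λ p q r → r :+ p :* (:0 :* q) := r) refl (u (suc n)) (v 0) _ ⟩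
      conv u (λ i → fromℕ (suc i) * v (suc i)) n
        ≈⟨ conv-cong n (λ i → refl) (τ-rec b) ⟩
      conv u (λ i → b * v i) n  ≈⟨ conv-*ʳ n b u v ⟩
      b * c ∎

  -- Convolving with partial sums yields the partial sums of the Cauchy product, whose coefficients
  -- are 1, 0, 0, ... by `conv-exp`.
  conv-expSeries : ∀ {a b} → a + b ≈ 0# → ∀ n → conv (τ a) (λ i → expSeries b (suc i)) n ≈ 1#
  conv-expSeries {a} {b} a+b≈0 zero = begin-equality
    τ a 0 * (τ b 0 + 0#)  ≈⟨ *-cong (τ-0 a) (trans (+-identityʳ _) (τ-0 b)) ⟩
    1# * 1#               ≈⟨ *-identityʳ 1# ⟩
    1#                    ∎
  conv-expSeries {a} {b} a+b≈0 (suc n) = begin-equality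
    conv (τ a) (λ i → expSeries b (suc i)) (suc n)
      ≈⟨ conv-cong (suc n) {u = τ a} (λ i → refl) (λ i → Σ<-last i (τ b)) ⟩
    conv (τ a) (λ i → expSeries b i + τ b i) (suc n)
      ≈⟨ conv-+ʳ (suc n) (τ a) (expSeries b) (τ b) ⟩
    conv (τ a) (expSeries b) (suc n) + conv (τ a) (τ b) (suc n)
      ≈⟨ +-cong (conv-last n (τ a) (expSeries b)) (conv-exp a+b≈0 n) ⟩
    conv (τ a) (λ i → expSeries b (suc i)) n + τ a (suc n) * 0# + 0#
      ≈⟨ +-congʳ (+-cong (conv-expSeries a+b≈0 n) (zeroʳ _)) ⟩
    1# + 0# + 0#
      ≈⟨ solve 0 (:1 :+ :0 :+ :0 := :1) refl ⟩
    1# ∎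

  conv-≥ : ∀ {B} n {u v} → (∀ i → 0# ≤ u i) → (∀ i → - B ≤ v i) → - (B * Σ< (suc n) u) ≤ conv u v n
  conv-≥ {B} zero {u} {v} 0≤u B≤v = begin
    - (B * (u 0 + 0#))  ≈⟨ solve 2 (λ B u → :- (B :* (u :+ :0)) := u :* :- B) refl B (u 0) ⟩
    u 0 * - B           ≤⟨ *-monoʳ-≤ (0≤u 0) (B≤v 0) ⟩
    u 0 * v 0           ∎
  conv-≥ {B} (suc n) {u} {v} 0≤u B≤v = begin
    - (B * (u 0 + Σ< (suc n) (u ∘ suc)))
      ≈⟨ solve 3 (λ B u s → :- (B :* (u :+ s)) := u :* :- B :+ :- (B :* s)) refl B (u 0) _ ⟩
    u 0 * - B + - (B * Σ< (suc n) (u ∘ suc))     ≤⟨ +-mono-≤ (*-monoʳ-≤ (0≤u 0) (B≤v (suc n))) (conv-≥ n (0≤u ∘ suc) B≤v) ⟩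
    u 0 * v (suc n) + conv (u ∘ suc) v n         ∎

  -- The first `r` terms of `u` meet `v` beyond index `M`, where `q` bounds it from below; for the
  -- other `M + 1` terms only the crude bound `- B` is at hand.
  conv-≥-tail : ∀ {B q M} r {u v} → (∀ i → 0# ≤ u i) → (∀ i → - B ≤ v i) → (∀ i → M ℕ.≤ i → q ≤ v i) →
    q * Σ< r u - B * (Σ< (suc (r ℕ.+ M)) u - Σ< r u) ≤ conv u v (r ℕ.+ M)
  conv-≥-tail {B} {q} {M} zero {u} {v} 0≤u B≤v q≤v = begin
    q * 0# - B * (Σ< (suc M) u - 0#)  ≈⟨ solve 3 (λ q B s → q :* :0 :- B :* (s :- :0) := :- (B :* s)) refl q B _ ⟩
    - (B * Σ< (suc M) u)              ≤⟨ conv-≥ M 0≤u B≤v ⟩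
    conv u v M                        ∎
  conv-≥-tail {B} {q} {M} (suc r) {u} {v} 0≤u B≤v q≤v = begin
    q * (u 0 + s) - B * ((u 0 + s′) - (u 0 + s))
      ≈⟨ solve 5 (λ q B u s s′ → q :* (u :+ s) :- B :* ((u :+ s′) :- (u :+ s)) :=
          u :* q :+ (q :* s :- B :* (s′ :- s))) refl q B (u 0) s s′ ⟩
    u 0 * q + (q * s - B * (s′ - s))
      ≤⟨ +-mono-≤ (*-monoʳ-≤ (0≤u 0) (q≤v (suc r ℕ.+ M) (ℕₚ.m≤n+m M (suc r)))) (conv-≥-tail r (0≤u ∘ suc) B≤v q≤v) ⟩
    conv u v (suc r ℕ.+ M) ∎
    where
    s = Σ< r (u ∘ suc)
    s′ = Σ< (suc (r ℕ.+ M)) (u ∘ suc)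

  bounded-below : ∀ M {q} (v : ℕ → Carrier) → (∀ i → M ℕ.≤ i → q ≤ v i) → ∃[ B ] 0# < B × (∀ i → - B ≤ v i)
  bounded-below zero {q} v q≤v with compare 0# q
  ... | tri< 0<q _ _ = 1# , 0<1 , λ i → ≤-trans (≤-by 1# 0≤1 (sym (-‿inverseˡ 1#))) (≤-trans (<⇒≤ 0<q) (q≤v i ℕ.z≤n))
  ... | tri≈ _ 0≈q _ = 1# , 0<1 , λ i → ≤-trans (≤-by 1# 0≤1 (sym (-‿inverseˡ 1#))) (≤-trans (inj₂ 0≈q) (q≤v i ℕ.z≤n))
  ... | tri> _ _ q<0 = - q , <-≤-trans (0<y-x q<0) (≤-reflexive (+-identityˡ _)) ,
        λ i → ≤-trans (≤-reflexive (solve 1 (λ q → :- (:- q) := q) refl q)) (q≤v i ℕ.z≤n)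
  bounded-below (suc M) {q} v q≤v with bounded-below M (v ∘ suc) (λ i M≤i → q≤v (suc i) (ℕ.s≤s M≤i)) | v 0 <? 0#
  ... | B , 0<B , B≤v | no v0≮0 = B , 0<B ,
        λ { zero → ≤-trans (≤-by B (<⇒≤ 0<B) (sym (-‿inverseˡ B))) (≮⇒≥ v0≮0) ; (suc i) → B≤v i }
  ... | B , 0<B , B≤v | yes v0<0 = B - v 0 , +-pos-nonNeg 0<B 0≤-v0 ,
        λ { zero → ≤-by B (<⇒≤ 0<B) (solve 2 (λ B v → v := :- (B :- v) :+ B) refl B (v 0))
          ; (suc i) → ≤-trans (≤-by (- v 0) 0≤-v0 (solve 2 (λ B v → :- B := :- (B :- v) :+ :- v) refl B (v 0))) (B≤v i) }
    where
    0≤-v0 : 0# ≤ - v 0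
    0≤-v0 = ≤-trans (0≤y-x (<⇒≤ v0<0)) (≤-reflexive (+-identityˡ _))

  -- The partial sums of u are bounded, so some window of length M + 1 contributes
  -- less than η; there conv u v is governed by the terms with v ≥ q.
  conv->1 : ∀ {u v : ℕ → Carrier} {q s B η K M} → (∀ i → 0# ≤ u i) → (∀ i → - B ≤ v i) → (∀ i → M ℕ.≤ i → q ≤ v i) →
    0# ≤ q → 0# < B → 0# < η → (∀ n → Σ< n u ≤ K) → (∀ k → s ≤ Σ< (2 ℕ.+ k) u) → 1# + B * η ≤ q * s →
    ¬ ¬ (∃[ n ] 1# < conv u v n)
  conv->1 {u} {v} {q} {s} {B} {η} {K} {M} 0≤u B≤v q≤v 0≤q 0<B 0<η u≤K s≤u 1+Bη≤qs none =
    archimedean K 0<η λ (J , K<Jη) → none (window J (first-step small? base J (≤-<-trans (u≤K (r J)) K<Jη)))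
    where
    r : ℕ → ℕ
    -- Windows have length M + 1 and start at 2, because `s` bounds only sums of at least two terms.
    r j = 2 ℕ.+ j ℕ.* suc M

    r-suc : ∀ j → r (suc j) ≡ suc (r j ℕ.+ M)
    r-suc j = ≡.cong (λ k → 2 ℕ.+ k) (≡.trans (ℕₚ.+-comm (suc M) (j ℕ.* suc M)) (ℕₚ.+-suc (j ℕ.* suc M) M))

    -- `Small` fails at 0 and holds once jη exceeds `K`. Where it begins to hold, the partial sum
    -- grew by less than η across the window.
    Small : ℕ → Set
    Small j = Σ< (r j) u < fromℕ j * η

    small? : ∀ j → Dec (Small j)
    small? j = Σ< (r j) u <? fromℕ j * η

    base : ¬ Small 0
    base = ≤⇒≯ (≤-trans (≤-reflexive (zeroˡ η)) (Σ<-nonNeg (r 0) 0≤u))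

    exceeds : ∀ t t′ → s ≤ t → t′ - t < η → 1# < q * t - B * (t′ - t)
    exceeds t t′ s≤t t′-t<η = begin-strict
      1#                       ≈⟨ solve 1 (λ e → :1 := (:1 :+ e) :- e) refl (B * η) ⟩
      (1# + B * η) - B * η     ≤⟨ +-monoˡ-≤ _ 1+Bη≤qs ⟩
      q * s - B * η            ≤⟨ +-monoˡ-≤ _ (*-monoʳ-≤ 0≤q s≤t) ⟩
      q * t - B * η            <⟨ <-by (B * (η - (t′ - t))) (*-positive 0<B (0<y-x t′-t<η))
          (solve 4 (λ p B η d → p :- B :* d := (p :- B :* η) :+ B :* (η :- d)) refl (q * t) B η (t′ - t)) ⟩
      q * t - B * (t′ - t)     ∎

    increment : ∀ t t′ j → ¬ (t < fromℕ j * η) → t′ < fromℕ (suc j) * η → t′ - t < η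
    increment t t′ j t≮ t′< = begin-strict
      t′ - t                     <⟨ +-monoˡ-< (- t) t′< ⟩
      fromℕ (suc j) * η - t
        ≤⟨ ≤-by (t - fromℕ j * η) (0≤y-x (≮⇒≥ t≮)) (solve 3 (λ j e s → e :=
            (:1 :+ j) :* e :- s :+ (s :- j :* e)) refl (fromℕ j) η t) ⟩
      η                          ∎

    window : ∀ J → ∃[ j ] suc j ℕ.≤ J × ¬ Small j × Small (suc j) → ∃[ n ] 1# < conv u v n
    window J (j , _ , ¬small , small′) = r j ℕ.+ M ,
      <-≤-trans (exceeds _ _ (s≤u (j ℕ.* suc M)) (increment _ _ j ¬small (≡.subst (λ k → Σ< k u < fromℕ (suc j) * η) (r-suc j) small′)))
                (conv-≥-tail (r j) 0≤u B≤v q≤v)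

  -- Suppose y < 0 and put a = -y. The series at a has bounded partial sums, at least 1 + a from the
  -- second on, and the partial sums at y eventually exceed 1 - δ because they tend to x ≥ 1.
  -- Convolving the terms at a with the partial sums at y would then exceed 1 somewhere, against
  -- `conv-expSeries`.
  ln-nonNeg : ∀ {x y} → IsLn x y → 1# ≤ x → 0# ≤ y
  ln-nonNeg {x} {y} lnx 1≤x = ≮⇒≥ λ y<0 → contradiction (<-≤-trans (0<y-x y<0) (≤-reflexive (+-identityˡ (- y))))
    where
    contradiction : 0# < - y → ⊥
    contradiction 0<a =
      archimedean a 0<¼ λ (n , a<n¼) →
      conv->1 (τ-nonNeg 0≤a) (proj₂ (proj₂ lower)) q≤v 0≤q 0<B (*-positive 0<h (⁻¹-positive 0<B))
        (λ N → exp-≤ N n 0≤a (<⇒≤ a<n¼)) S≥1+a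
        (≤-reflexive (trans (+-congˡ (y*[x/y]≈x 0<B)) (sym q[1+a]≈1+h)))
        λ (N , 1<conv) → ≤⇒≯ (≤-reflexive (conv-expSeries (-‿inverseˡ y) N)) 1<conv
      where
      a h δ q : Carrier
      a = - y
      h = a / fromℕ 2
      -- Chosen so that (1 - δ)(1 + a) = 1 + a/2. The surplus h = a/2 pays for the loss Bη, with η =
      -- h / B.
      δ = h / (1# + a)
      q = 1# - δ

      0≤a : 0# ≤ a
      0≤a = <⇒≤ 0<a

      0<1+a : 0# < 1# + a
      0<1+a = +-pos-nonNeg 0<1 0≤a

      h+h≈a : h + h ≈ a
      h+h≈a = trans (solve 1 (λ h → h :+ h := (:1 :+ (:1 :+ :0)) :* h) refl h) (y*[x/y]≈x (fromℕ-suc-pos 1))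

      0<h : 0# < h
      0<h = *-positive 0<a (⁻¹-positive (fromℕ-suc-pos 1))

      0<δ : 0# < δ
      0<δ = *-positive 0<h (⁻¹-positive 0<1+a)

      0≤q : 0# ≤ q
      0≤q = 0≤y-x (/-≤ 0<1+a (begin
        h
          ≤⟨ ≤-by (1# + h) (+-nonNeg 0≤1 (<⇒≤ 0<h)) (trans (*-identityʳ _) (trans (+-congˡ (sym h+h≈a)) (solve 1 (λ h → :1 :+ (h :+ h) :=
              h :+ (:1 :+ h)) refl h))) ⟩
        (1# + a) * 1#      ∎))

      q[1+a]≈1+h : q * (1# + a) ≈ 1# + h
      q[1+a]≈1+h = begin-equality
        q * (1# + a)             ≈⟨ solve 2 (λ a d → (:1 :- d) :* (:1 :+ a) := :1 :+ a :- (:1 :+ a) :* d) refl a δ ⟩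
        1# + a - (1# + a) * δ    ≈⟨ +-cong (+-congˡ (sym h+h≈a)) (-‿cong (y*[x/y]≈x 0<1+a)) ⟩
        1# + (h + h) - h         ≈⟨ solve 1 (λ h → :1 :+ (h :+ h) :- h := :1 :+ h) refl h ⟩
        1# + h                   ∎

      S≥1+a : ∀ k → 1# + a ≤ expSeries a (2 ℕ.+ k)
      S≥1+a k = begin
        1# + a
          ≤⟨ ≤-by r (Σ<-nonNeg k {λ i → τ a (2 ℕ.+ i)} (λ i → τ-nonNeg 0≤a (2 ℕ.+ i))) refl ⟩
        1# + a + r                              ≈⟨ +-assoc 1# a r ⟩
        1# + (a + r)                            ≈⟨ +-cong (τ-0 a) (+-congʳ (τ-1 a)) ⟨
        expSeries a (2 ℕ.+ k)                   ∎
        where r = Σ< k (λ i → τ a (2 ℕ.+ i))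

      M : ℕ
      M = proj₁ (lnx δ 0<δ)

      q≤v : ∀ i → M ℕ.≤ i → q ≤ expSeries y (suc i)
      q≤v i M≤i = begin
        1# - δ  ≤⟨ +-monoˡ-≤ (- δ) 1≤x ⟩
        x - δ   ≤⟨ <⇒≤ (proj₁ (proj₂ (lnx δ 0<δ) (suc i) (ℕₚ.m≤n⇒m≤1+n M≤i))) ⟩
        expSeries y (suc i)     ∎

      lower : ∃[ B ] 0# < B × (∀ i → - B ≤ expSeries y (suc i))
      lower = bounded-below M (λ i → expSeries y (suc i)) q≤v

      0<B : 0# < proj₁ lower
      0<B = proj₁ (proj₂ lower)

  exp-upper : ∀ {x y} n → IsLn x y → 0# ≤ y → y ≤ fromℕ n * ¼ → x ≤ ρ ^ n
  exp-upper n lnx 0≤y y≤n¼ = limit-≤ lnx λ M → exp-≤ M n 0≤y y≤n¼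

  1<ρ : 1# < ρ
  1<ρ = <-by ⅓ 0<⅓ ρ≈1+⅓

  ρ^n<ρ^1+n : ∀ n → ρ ^ n < ρ ^ suc n
  ρ^n<ρ^1+n n = begin-strict
    ρ ^ n       ≈⟨ trans (*-comm _ _) (*-identityʳ _) ⟨
    1# * ρ ^ n  ≈⟨ *-comm _ _ ⟩
    ρ ^ n * 1#  <⟨ *-monoʳ-< (^-pos 0<ρ n) 1<ρ ⟩
    ρ ^ n * ρ   ≈⟨ *-comm _ _ ⟩
    ρ ^ suc n   ∎

  -- By `exp-upper`, a power ρ^n below x has n ≤ 4 y; the next power already reaches x.
  log-bound : ∀ {x y} → IsLn x y → 1# ≤ x →
              ¬ ¬ (∃[ N ] x < ρ ^ N × fromℕ N ≤ fromℕ 4 * (1# + y))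
  log-bound {x} {y} lnx 1≤x none = archimedean x 0<⅓ λ (N , x<N⅓) →
    none (find N (≤-trans (<⇒≤ x<N⅓) (≤-trans (≤-by 1# 0≤1 (+-comm _ _)) (ρ^-bernoulli N))))
    where
    0≤y : 0# ≤ y
    0≤y = ln-nonNeg lnx 1≤x

    find : ∀ N → x ≤ ρ ^ N → ∃[ N ] x < ρ ^ N × fromℕ N ≤ fromℕ 4 * (1# + y)
    find N x≤ρᴺ with x ≤? 1#
    ... | yes x≤1 = 1 , ≤-<-trans x≤1 (ρ^n<ρ^1+n 0) , (begin
          fromℕ 1             ≤⟨ ≤-by (fromℕ 3 + fromℕ 4 * y) (+-nonNeg (fromℕ-nonNeg 3) (*-nonNeg (fromℕ-nonNeg 4) 0≤y))
              (solve 2 (λ t y → (:1 :+ t) :* (:1 :+ y) := (:1 :+ :0) :+ (t :+ (:1 :+ t) :* y)) refl (fromℕ 3) y) ⟩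
          fromℕ 4 * (1# + y)  ∎)
    ... | no x≰1 with first-step (λ n → x ≤? (ρ ^ n)) x≰1 N x≤ρᴺ
    -- The first `suc` reaches x and the second makes the inequality strict; the 4 in 4 (1 + y)
    -- covers both.
    ...   | n , _ , x≰ρⁿ , x≤ρ¹⁺ⁿ = suc (suc n) , ≤-<-trans x≤ρ¹⁺ⁿ (ρ^n<ρ^1+n (suc n)) , (begin
          fromℕ (suc (suc n))                ≈⟨ solve 1 (λ n → :1 :+ (:1 :+ n) := (:1 :+ :1) :+ n :* :1) refl (fromℕ n) ⟩
          (1# + 1#) + fromℕ n * 1#           ≈⟨ +-congˡ (*-congˡ 4*¼≈1) ⟨
          (1# + 1#) + fromℕ n * (fromℕ 4 * ¼)
            ≤⟨ ≤-by ((1# + 1#) + fromℕ 4 * (y - fromℕ n * ¼)) (+-nonNeg (+-nonNeg 0≤1 0≤1) (*-nonNeg (fromℕ-nonNeg 4) (0≤y-x n¼≤y)))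
              (solve 3 (λ n q y → four :* (:1 :+ y) :=
                  ((:1 :+ :1) :+ n :* (four :* q)) :+ ((:1 :+ :1) :+ four :* (y :- n :* q))) refl (fromℕ n) ¼ y) ⟩
          fromℕ 4 * (1# + y)                 ∎)
      where
      four : ∀ {k} → Polynomial k
      four = :1 :+ (:1 :+ (:1 :+ (:1 :+ :0)))
      n¼≤y : fromℕ n * ¼ ≤ y
      n¼≤y = ≮⇒≥ λ y<n¼ → x≰ρⁿ (exp-upper n lnx 0≤y (<⇒≤ y<n¼))

-- A potential in place of the logarithm.

module LogPotential (ℛ : Reals) where

  open Reals ℛ hiding (zero)
  open OrderedField ℛ
  open Logarithm ℛ
  open Reasoning

  two : Carrier
  two = 1# + 1#

  0<2 : 0# < two
  0<2 = +-pos-nonNeg 0<1 0≤1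

  cap : Carrier → Carrier
  cap x with x <? 1#
  ... | yes _ = x
  ... | no  _ = 1#

  cap-≤1 : ∀ x → cap x ≤ 1#
  cap-≤1 x with x <? 1#
  ... | yes x<1 = <⇒≤ x<1
  ... | no  _   = ≤-refl

  cap-≤ : ∀ x → cap x ≤ x
  cap-≤ x with x <? 1#
  ... | yes _   = ≤-refl
  ... | no  x≮1 = ≮⇒≥ x≮1

  cap-≥ : ∀ {x} → x ≤ 1# → x ≤ cap x
  cap-≥ {x} x≤1 with x <? 1#
  ... | yes _ = ≤-refl
  ... | no  _ = x≤1

  cap-nonNeg : ∀ {x} → 0# ≤ x → 0# ≤ cap x
  cap-nonNeg {x} 0≤x with x <? 1#
  ... | yes _ = 0≤x
  ... | no  _ = 0≤1

  cap-mono : ∀ {x y} → x ≤ y → cap x ≤ cap y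
  cap-mono {x} {y} x≤y with y <? 1#
  ... | yes _ = ≤-trans (cap-≤ x) x≤y
  ... | no  _ = cap-≤1 x

  Σ<-drop : ∀ n {a b : ℕ → Carrier} {d} r → r ℕ.< n → (∀ i → a i ≤ b i) → d + a r ≤ b r → d + Σ< n a ≤ Σ< n b
  Σ<-drop (suc n) {a} {b} {d} zero _ a≤b d+a≤b = begin
    d + (a 0 + Σ< n (a ∘ suc))  ≈⟨ +-assoc d _ _ ⟨
    (d + a 0) + Σ< n (a ∘ suc)  ≤⟨ +-mono-≤ d+a≤b (Σ<-mono n (a≤b ∘ suc)) ⟩
    b 0 + Σ< n (b ∘ suc)        ∎
  Σ<-drop (suc n) {a} {b} {d} (suc r) (ℕ.s≤s r<n) a≤b d+a≤b = begin
    d + (a 0 + Σ< n (a ∘ suc))  ≈⟨ solve 3 (λ d a s → d :+ (a :+ s) := a :+ (d :+ s)) refl d (a 0) _ ⟩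
    a 0 + (d + Σ< n (a ∘ suc))  ≤⟨ +-mono-≤ (a≤b 0) (Σ<-drop n r r<n (a≤b ∘ suc) d+a≤b) ⟩
    b 0 + Σ< n (b ∘ suc)        ∎

  Σ<-≤n : ∀ n {a : ℕ → Carrier} → (∀ i → a i ≤ 1#) → Σ< n a ≤ fromℕ n
  Σ<-≤n zero    a≤1 = ≤-refl
  Σ<-≤n (suc n) a≤1 = +-mono-≤ (a≤1 0) (Σ<-≤n n (a≤1 ∘ suc))

  -- `φ` stands for 1 + ln (g/ε) as a function of the deficit g = 1 - f. By `φ-drop` the relative
  -- decreases of a deficit telescope to at most Λ; `g′` may be 0, which covers the step that
  -- completes a function.
  record Potential (ε Λ : Carrier) : Set where
    field
      φ      : Carrier → Carrier
      φ-≥0   : ∀ {g} → 0# ≤ g → 0# ≤ φ g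
      φ-≤    : ∀ g → φ g ≤ Λ
      φ-drop : ∀ {g g′} → ε ≤ g → g ≤ 1# → g′ ≤ g → (g - g′) / g + φ g′ ≤ φ g

  -- A discrete substitute for the logarithm: of the scales ε ρ^r, some one lies
  -- within a factor ρ above g, and its summand alone drops fast enough.
  potential : ∀ {ε} M → 0# < ε → 1# ≤ ρ ^ M * ε → Potential ε (two * fromℕ (suc M))
  potential {ε} M 0<ε 1≤top = record
    { φ      = φ
    ; φ-≥0   = λ {g} 0≤g → *-nonNeg (<⇒≤ 0<2) (Σ<-nonNeg (suc M) λ r → cap-nonNeg (/-nonNeg 0≤g (v-pos r)))
    ; φ-≤    = λ g → *-monoʳ-≤ (<⇒≤ 0<2) (Σ<-≤n (suc M) λ r → cap-≤1 (g / v r))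
    ; φ-drop = λ {g} {g′} ε≤g g≤1 g′≤g → let r , r<1+M , g≤v , v≤2g = level ε≤g g≤1 in drop g g′ r r<1+M (<-≤-trans 0<ε ε≤g) g′≤g g≤v v≤2g
    }
    where
    v : ℕ → Carrier
    v r = ρ ^ r * ε

    v-pos : ∀ r → 0# < v r
    v-pos r = *-positive (^-pos 0<ρ r) 0<ε

    φ : Carrier → Carrier
    -- At the scale picked for g, the bound g ≤ v r keeps `cap` from truncating, and v r ≤ 2 g turns
    -- division by v r into division by g at the price of the factor `two`.
    φ g = two * Σ< (suc M) (λ r → cap (g / v r))

    ⅓≤1 : ⅓ ≤ 1#
    ⅓≤1 = *-cancelˡ-≤ (fromℕ-suc-pos 2) (begin
      fromℕ 3 * ⅓   ≈⟨ x*x⁻¹≈1 (fromℕ-suc-pos 2) ⟩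
      1#            ≤⟨ ≤-by two (<⇒≤ 0<2) (solve 0 ((:1 :+ (:1 :+ (:1 :+ :0))) :* :1 := :1 :+ (:1 :+ :1)) refl) ⟩
      fromℕ 3 * 1#  ∎)

    ρ≤2 : ρ ≤ two
    ρ≤2 = ≤-trans (≤-reflexive ρ≈1+⅓) (+-monoʳ-≤ 1# ⅓≤1)

    level : ∀ {g} → ε ≤ g → g ≤ 1# → ∃[ r ] r ℕ.< suc M × g ≤ v r × v r ≤ two * g
    level {g} ε≤g g≤1 with g ≤? v 0
    ... | yes g≤v₀ = 0 , ℕ.s≤s ℕ.z≤n , g≤v₀ , (begin
          1# * ε   ≈⟨ *-identityˡ ε ⟩
          ε        ≤⟨ ε≤g ⟩
          g        ≤⟨ ≤-by g (≤-trans (<⇒≤ 0<ε) ε≤g) (solve 1 (λ g → (:1 :+ :1) :* g := g :+ g) refl g) ⟩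
          two * g  ∎)
    ... | no g≰v₀ with first-step (λ r → g ≤? v r) g≰v₀ M (≤-trans g≤1 1≤top)
    ...   | r , r<M , g≰v , g≤v = suc r , ℕ.s≤s r<M , g≤v , (begin
          ρ * ρ ^ r * ε    ≈⟨ *-assoc ρ (ρ ^ r) ε ⟩
          ρ * v r          ≤⟨ *-mono-≤ (<⇒≤ (v-pos r)) (<⇒≤ 0<2) ρ≤2 (<⇒≤ (≰⇒> g≰v)) ⟩
          two * g          ∎)

    drop : ∀ g g′ r → r ℕ.< suc M → 0# < g → g′ ≤ g → g ≤ v r → v r ≤ two * g → (g - g′) / g + φ g′ ≤ φ g
    drop g g′ r r<1+M 0<g g′≤g g≤v v≤2g = begin
      (g - g′) / g + two * Σ′                    ≤⟨ +-monoˡ-≤ _ ratio ⟩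
      two * ((g - g′) / v r) + two * Σ′          ≈⟨ distribˡ two _ _ ⟨
      two * ((g - g′) / v r + Σ′)                ≤⟨ *-monoʳ-≤ (<⇒≤ 0<2) (Σ<-drop (suc M) r r<1+M
                                                      (λ i → cap-mono (*-monoˡ-≤ (<⇒≤ (⁻¹-positive (v-pos i))) g′≤g)) one) ⟩
      φ g                                        ∎
      where
      Σ′ = Σ< (suc M) (λ r → cap (g′ / v r))
      ratio : (g - g′) / g ≤ two * ((g - g′) / v r)
      ratio = /-≤ 0<g (*-cancelˡ-≤ (v-pos r) (begin
        v r * (g - g′)                            ≤⟨ *-monoˡ-≤ (0≤y-x g′≤g) v≤2g ⟩
        two * g * (g - g′)                        ≈⟨ *-congˡ (y*[x/y]≈x (v-pos r)) ⟨
        two * g * (v r * ((g - g′) / v r))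
          ≈⟨ solve 4 (λ t g v q → t :* g :* (v :* q) := v :* (g :* (t :* q))) refl two g (v r) _ ⟩
        v r * (g * (two * ((g - g′) / v r)))      ∎))
      one : (g - g′) / v r + cap (g′ / v r) ≤ cap (g / v r)
      one = begin
        (g - g′) / v r + cap (g′ / v r)  ≤⟨ +-monoʳ-≤ _ (cap-≤ (g′ / v r)) ⟩
        (g - g′) / v r + g′ / v r        ≈⟨ solve 3 (λ g h v → (g :- h) :* v :+ h :* v := g :* v) refl g g′ (v r ⁻¹) ⟩
        g / v r                          ≤⟨ cap-≥ (/-≤ (v-pos r) (≤-trans g≤v (≤-reflexive (sym (*-identityʳ (v r)))))) ⟩
        cap (g / v r)                    ∎

-- Sums, maxima and searches over natural numbers.

sumℕ-mono : ∀ {n} {g h : Fin n → ℕ} → (∀ i → g i ℕ.≤ h i) → sumℕ g ℕ.≤ sumℕ h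
sumℕ-mono {zero}  g≤h = ℕ.z≤n
sumℕ-mono {suc n} g≤h = ℕₚ.+-mono-≤ (g≤h fzero) (sumℕ-mono (g≤h ∘ fsuc))

private
  interchange : ∀ a b c d → (a ℕ.+ b) ℕ.+ (c ℕ.+ d) ≡ (a ℕ.+ c) ℕ.+ (b ℕ.+ d)
  interchange = solve 4 (λ a b c d → (a :+ b) :+ (c :+ d) := (a :+ c) :+ (b :+ d)) ≡.refl
    where open +-*-Solver

sumℕ-+ : ∀ {n} (g h : Fin n → ℕ) → sumℕ (λ i → g i ℕ.+ h i) ≡ sumℕ g ℕ.+ sumℕ h
sumℕ-+ {zero}  g h = ≡.refl
sumℕ-+ {suc n} g h = ≡.trans (≡.cong (g fzero ℕ.+ h fzero ℕ.+_) (sumℕ-+ (g ∘ fsuc) (h ∘ fsuc)))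
  (interchange (g fzero) (h fzero) _ _)

sumℕ-* : ∀ {n} c (g : Fin n → ℕ) → sumℕ (λ i → c ℕ.* g i) ≡ c ℕ.* sumℕ g
sumℕ-* {zero}  c g = ≡.sym (ℕₚ.*-zeroʳ c)
sumℕ-* {suc n} c g = ≡.trans (≡.cong (c ℕ.* g fzero ℕ.+_) (sumℕ-* c (g ∘ fsuc)))
  (≡.sym (ℕₚ.*-distribˡ-+ c (g fzero) _))

sumℕ-zero : ∀ {n} {g : Fin n → ℕ} → (∀ i → g i ≡ 0) → sumℕ g ≡ 0
sumℕ-zero {zero}  g≡0 = ≡.refl
sumℕ-zero {suc n} g≡0 = ≡.cong₂ ℕ._+_ (g≡0 fzero) (sumℕ-zero (g≡0 ∘ fsuc))

sumℕ-≤-term : ∀ {n} (g : Fin n → ℕ) i → g i ℕ.≤ sumℕ g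
sumℕ-≤-term g fzero    = ℕₚ.m≤m+n _ _
sumℕ-≤-term g (fsuc i) = ℕₚ.≤-trans (sumℕ-≤-term (g ∘ fsuc) i) (ℕₚ.m≤n+m _ (g fzero))

≤-maxℕ : ∀ {n} (g : Fin n → ℕ) i → g i ℕ.≤ maxℕ g
≤-maxℕ g fzero    = ℕₚ.m≤m⊔n _ _
≤-maxℕ g (fsuc i) = ℕₚ.≤-trans (≤-maxℕ (g ∘ fsuc) i) (ℕₚ.m≤n⊔m (g fzero) _)

maxℕ-induction : (P : ℕ → Set) → P 0 → ∀ {n} (g : Fin n → ℕ) → (∀ i → P (g i)) → P (maxℕ g)
maxℕ-induction P P0 {zero}  g Pg = P0
maxℕ-induction P P0 {suc n} g Pg with ℕₚ.⊔-sel (g fzero) (maxℕ (g ∘ fsuc))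
... | inj₁ eq = ≡.subst P (≡.sym eq) (Pg fzero)
... | inj₂ eq = ≡.subst P (≡.sym eq) (maxℕ-induction P P0 (g ∘ fsuc) (Pg ∘ fsuc))

firstFrom-≤ : ∀ {P : ℕ → Set} (P? : ∀ t → Dec (P t)) t d {u} → P u → t ℕ.≤ u → firstFrom P? t d ℕ.≤ u
firstFrom-≤ P? t zero    Pu t≤u = t≤u
firstFrom-≤ P? t (suc d) {u} Pu t≤u with P? t
... | yes _   = t≤u
... | no ¬Pt = firstFrom-≤ P? (suc t) d Pu (ℕₚ.≤∧≢⇒< t≤u λ { ≡.refl → ¬Pt Pu })

firstFrom-≤-max : ∀ {P : ℕ → Set} (P? : ∀ t → Dec (P t)) t d → firstFrom P? t d ℕ.≤ t ℕ.+ d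
firstFrom-≤-max P? t zero    = ℕₚ.m≤m+n t 0
firstFrom-≤-max P? t (suc d) with P? t
... | yes _ = ℕₚ.m≤m+n t (suc d)
... | no  _ = ≡.subst (firstFrom P? (suc t) d ℕ.≤_) (≡.sym (ℕₚ.+-suc t d)) (firstFrom-≤-max P? (suc t) d)

firstFrom-≥ : ∀ {P : ℕ → Set} (P? : ∀ t → Dec (P t)) t d → t ℕ.≤ firstFrom P? t d
firstFrom-≥ P? t zero    = ℕₚ.≤-refl
firstFrom-≥ P? t (suc d) with P? t
... | yes _ = ℕₚ.≤-refl
... | no  _ = ℕₚ.<⇒≤ (firstFrom-≥ P? (suc t) d)

firstFrom-sat : ∀ {P : ℕ → Set} (P? : ∀ t → Dec (P t)) t d → P (t ℕ.+ d) → P (firstFrom P? t d)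
firstFrom-sat {P} P? t zero    P-last = ≡.subst P (ℕₚ.+-identityʳ t) P-last
firstFrom-sat {P} P? t (suc d) P-last with P? t
... | yes Pt = Pt
... | no  _  = firstFrom-sat P? (suc t) d (≡.subst P (ℕₚ.+-suc t d) P-last)

-- Decidable subsets and prefixes of a permutation.

∈-tabulate⁺ : ∀ {n} {P : Fin n → Set} (P? : ∀ i → Dec (P i)) {i} → P i → i ∈ tabulate (λ i → does (P? i))
∈-tabulate⁺ P? {i} Pi = Vecₚ.lookup⇒[]= i _ (≡.trans (Vecₚ.lookup∘tabulate _ i) (dec-true (P? i) Pi))

∈-tabulate⁻ : ∀ {n} {P : Fin n → Set} (P? : ∀ i → Dec (P i)) {i} → i ∈ tabulate (λ i → does (P? i)) → P i
∈-tabulate⁻ P? {i} i∈ with P? i in eq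
... | yes Pi = Pi
... | no  _  with ≡.trans (≡.sym (≡.cong does eq)) (≡.trans (≡.sym (Vecₚ.lookup∘tabulate _ i)) (Vecₚ.[]=⇒lookup i∈))
...   | ()

module _ {n} (π : Permutation′ n) where

  ∈-prefix⁺ : ∀ {t x} → toℕ (π ⟨$⟩ˡ x) ℕ.< t → x ∈ prefix π t
  ∈-prefix⁺ {t} = ∈-tabulate⁺ (λ x → toℕ (π ⟨$⟩ˡ x) ℕₚ.<? t)

  ∈-prefix⁻ : ∀ {t x} → x ∈ prefix π t → toℕ (π ⟨$⟩ˡ x) ℕ.< t
  ∈-prefix⁻ {t} = ∈-tabulate⁻ (λ x → toℕ (π ⟨$⟩ˡ x) ℕₚ.<? t)

  prefix-mono : ∀ {s t} → s ℕ.≤ t → prefix π s ⊆ prefix π t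
  prefix-mono s≤t x∈ = ∈-prefix⁺ (ℕₚ.<-≤-trans (∈-prefix⁻ x∈) s≤t)

  ⊤⊆prefix : ⊤ ⊆ prefix π n
  ⊤⊆prefix {x} _ = ∈-prefix⁺ (Finₚ.toℕ<n (π ⟨$⟩ˡ x))

  prefix-add : ∀ t → prefix π (toℕ t) ∪ ⁅ π ⟨$⟩ʳ t ⁆ ⊆ prefix π (suc (toℕ t))
  prefix-add t x∈ with x∈p∪q⁻ _ _ x∈
  ... | inj₁ x∈S = prefix-mono (ℕₚ.n≤1+n _) x∈S
  ... | inj₂ x∈e with x∈⁅y⁆⇒x≡y _ x∈e
  ...   | ≡.refl = ∈-prefix⁺ (≡.subst (λ i → toℕ i ℕ.< suc (toℕ t)) (≡.sym (inverseˡ π)) ℕₚ.≤-refl)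

  -- Stated for every `t`, because the length L at which σ is cut may exceed n. Past the end the
  -- prefix no longer grows and any element serves as `e`.
  prefix-suc : 0 ℕ.< n → ∀ t → ∃[ e ] prefix π (suc t) ⊆ prefix π t ∪ ⁅ e ⁆
  prefix-suc 0<n t with t ℕₚ.<? n
  ... | yes t<n = π ⟨$⟩ʳ fromℕ< t<n , sub
    where
    sub : prefix π (suc t) ⊆ prefix π t ∪ ⁅ π ⟨$⟩ʳ fromℕ< t<n ⁆
    sub {x} x∈ with toℕ (π ⟨$⟩ˡ x) ℕₚ.<? t
    ... | yes p = x∈p∪q⁺ (inj₁ (∈-prefix⁺ p))
    ... | no ¬p = x∈p∪q⁺ (inj₂ (≡.subst (_∈ ⁅ π ⟨$⟩ʳ fromℕ< t<n ⁆) same (x∈⁅x⁆ _)))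
      where
      same : π ⟨$⟩ʳ fromℕ< t<n ≡ x
      same = ≡.trans (≡.cong (π ⟨$⟩ʳ_) (Finₚ.toℕ-injective (≡.trans (Finₚ.toℕ-fromℕ< t<n)
        (ℕₚ.≤-antisym (ℕₚ.≮⇒≥ ¬p) (ℕₚ.≤-pred (∈-prefix⁻ x∈)))))) (inverseʳ π)
  ... | no t≮n = π ⟨$⟩ʳ fromℕ< 0<n , λ {x} _ →
      x∈p∪q⁺ (inj₁ (∈-prefix⁺ (ℕₚ.<-≤-trans (Finₚ.toℕ<n (π ⟨$⟩ˡ x)) (ℕₚ.≮⇒≥ t≮n))))

-- Normalised gains of sets, and the potential of a group of agents.

module Gain (ℛ : Reals) {n k m : ℕ} (I : SRMA ℛ n k m) where

  open Reals ℛ hiding (zero)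
  open OrderedField ℛ
  open Logarithm ℛ
  open LogPotential ℛ
  open SemiringSum semiring using (∑-distrib-+; *-distribˡ-sum)
  open Reasoning
  open SRMA I
  open IsMonotoneSubmodular

  -- The Iverson bracket, in the shape of the conditionals inside `score`.
  [_]_ : {P : Set} → Dec P → Carrier → Carrier
  [ d ] x = if does d then x else 0#

  []-mono : ∀ {P : Set} (d : Dec P) {x y} → (P → x ≤ y) → [ d ] x ≤ [ d ] y
  []-mono (yes p) x≤y = x≤y p
  []-mono (no  _) x≤y = ≤-refl

  []-+ : ∀ {P : Set} (d : Dec P) x y → [ d ] (x + y) ≈ [ d ] x + [ d ] y
  []-+ (yes _) x y = refl
  []-+ (no  _) x y = sym (+-identityʳ 0#)

  []-* : ∀ {P : Set} (d : Dec P) c x → [ d ] (c * x) ≈ c * [ d ] x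
  []-* (yes _) c x = refl
  []-* (no  _) c x = sym (zeroʳ c)

  sum-mono-+ : ∀ {l} {a b c : Fin l → Carrier} → (∀ i → a i ≤ b i + c i) → sum a ≤ sum b + sum c
  sum-mono-+ {a = a} {b} {c} a≤b+c = ≤-trans (sum-mono a≤b+c) (≤-reflexive (∑-distrib-+ b c))

  sum-+-mono : ∀ {l} {a b c : Fin l → Carrier} → (∀ i → a i + b i ≤ c i) → sum a + sum b ≤ sum c
  sum-+-mono {a = a} {b} {c} a+b≤c = ≤-trans (≤-reflexive (sym (∑-distrib-+ a b))) (sum-mono a+b≤c)

  sum-nonNeg : ∀ {l} {g : Fin l → Carrier} → (∀ i → 0# ≤ g i) → 0# ≤ sum g
  sum-nonNeg {zero}  0≤g = ≤-refl
  sum-nonNeg {suc l} 0≤g = +-nonNeg (0≤g fzero) (sum-nonNeg (0≤g ∘ fsuc))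

  fromℕ-sumℕ : ∀ {l} (g : Fin l → ℕ) → fromℕ (sumℕ g) ≈ sum (λ i → fromℕ (g i))
  fromℕ-sumℕ {zero}  g = refl
  fromℕ-sumℕ {suc l} g = trans (fromℕ-+ (g fzero) _) (+-congˡ (fromℕ-sumℕ (g ∘ fsuc)))

  sumOver : ∀ {l} → Subset l → (Fin l → Carrier) → Carrier
  sumOver A g = sum λ i → [ i ∈? A ] g i

  sumOver-mono : ∀ {l} (A : Subset l) {g h : Fin l → Carrier} → (∀ i → i ∈ A → g i ≤ h i) → sumOver A g ≤ sumOver A h
  sumOver-mono A g≤h = sum-mono λ i → []-mono (i ∈? A) (g≤h i)

  sumOver-+ : ∀ {l} (A : Subset l) (g h : Fin l → Carrier) → sumOver A (λ i → g i + h i) ≤ sumOver A g + sumOver A h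
  sumOver-+ A g h = sum-mono-+ λ i → ≤-reflexive ([]-+ (i ∈? A) (g i) (h i))

  sumOver-+′ : ∀ {l} (A : Subset l) (g h : Fin l → Carrier) → sumOver A g + sumOver A h ≤ sumOver A (λ i → g i + h i)
  sumOver-+′ A g h = sum-+-mono λ i → ≤-reflexive (sym ([]-+ (i ∈? A) (g i) (h i)))

  sumOver-⊆ : ∀ {l} {A B : Subset l} {g : Fin l → Carrier} → A ⊆ B → (∀ i → 0# ≤ g i) → sumOver A g ≤ sumOver B g
  sumOver-⊆ {A = A} {B} {g} A⊆B 0≤g = sum-mono λ i → term i (i ∈? A) (i ∈? B)
    where
    term : ∀ i (a : Dec (i ∈ A)) (b : Dec (i ∈ B)) → [ a ] g i ≤ [ b ] g i
    term i (yes a) (yes b) = ≤-refl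
    term i (yes a) (no ¬b) = ⊥-elim (¬b (A⊆B a))
    term i (no ¬a) (yes b) = 0≤g i
    term i (no ¬a) (no ¬b) = ≤-refl

  sumOver-* : ∀ {l} (A : Subset l) c (g : Fin l → Carrier) → sumOver A (λ i → c * g i) ≈ c * sumOver A g
  sumOver-* A c g = trans (≤-antisym
      (sum-mono λ i → ≤-reflexive ([]-* (i ∈? A) c (g i))) (sum-mono λ i → ≤-reflexive (sym ([]-* (i ∈? A) c (g i)))))
    (sym (*-distribˡ-sum c (λ i → [ i ∈? A ] g i)))

  sumOver-const : ∀ {l} (A : Subset l) c → sumOver A (λ _ → c) ≈ fromℕ ∣ A ∣ * c
  sumOver-const []            c = sym (zeroˡ c)
  sumOver-const (inside ∷ A)  c = trans (+-congˡ (sumOver-const A c)) (solve 2 (λ a c → c :+ a :* c :=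
      (:1 :+ a) :* c) refl (fromℕ ∣ A ∣) c)
  sumOver-const (outside ∷ A) c = trans (+-identityˡ _) (sumOver-const A c)

  f-mono : ∀ i j {S T} → S ⊆ T → f i j S ≤ f i j T
  f-mono i j = monotone (f-ms i j)

  f-top : ∀ i j {S} → ⊤ ⊆ S → f i j S ≈ 1#
  f-top i j {S} ⊤⊆S = ≤-antisym (f-≤1 i j S) (≤-trans (≤-reflexive (sym (f-full i j))) (f-mono i j ⊤⊆S))

  Unsat : Fin k → Fin m → Subset n → Set
  Unsat i j S = f i j S < 1#

  unsat? : ∀ i j S → Dec (Unsat i j S)
  unsat? i j S = f i j S <? 1#

  w-≥0 : ∀ i j → 0# ≤ fromℕ (w i j)
  w-≥0 i j = fromℕ-nonNeg (w i j)

  ratio : Fin k → Fin m → Subset n → Subset n → Carrier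
  ratio i j S T = (f i j T - f i j S) / (1# - f i j S)

  -- The summand of `score` with any set `T` in place of `S ∪ ⁅ e ⁆`, so that a whole prefix of σ
  -- can be compared with single elements.
  gainTerm : Fin k → Fin m → Subset n → Subset n → Carrier
  gainTerm i j S T = [ unsat? i j S ] (fromℕ (w i j) * ratio i j S T)

  ratio-mono : ∀ i j {S T T′} → Unsat i j S → T ⊆ T′ → ratio i j S T ≤ ratio i j S T′
  ratio-mono i j S<1 T⊆T′ = *-monoˡ-≤ (<⇒≤ (⁻¹-positive (0<y-x S<1))) (+-monoˡ-≤ _ (f-mono i j T⊆T′))

  ratio-nonNeg : ∀ i j {S T} → Unsat i j S → S ⊆ T → 0# ≤ ratio i j S T
  ratio-nonNeg i j S<1 S⊆T = /-nonNeg (0≤y-x (f-mono i j S⊆T)) (0<y-x S<1)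

  gainTerm-mono : ∀ i j S {T T′} → T ⊆ T′ → gainTerm i j S T ≤ gainTerm i j S T′
  gainTerm-mono i j S T⊆T′ = []-mono (unsat? i j S) λ u → *-monoʳ-≤ (w-≥0 i j) (ratio-mono i j u T⊆T′)

  gainTerm-≥0 : ∀ i j S {T} → S ⊆ T → 0# ≤ gainTerm i j S T
  gainTerm-≥0 i j S S⊆T with unsat? i j S
  ... | yes u = *-nonNeg (w-≥0 i j) (ratio-nonNeg i j u S⊆T)
  ... | no  _ = ≤-refl

  gainTerm-≤0 : ∀ i j S {T} → T ⊆ S → gainTerm i j S T ≤ 0#
  gainTerm-≤0 i j S {T} T⊆S with unsat? i j S
  ... | no  _ = ≤-refl
  ... | yes u = begin
    fromℕ (w i j) * ratio i j S T   ≤⟨ *-monoʳ-≤ (w-≥0 i j) (ratio-mono i j u T⊆S) ⟩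
    fromℕ (w i j) * ratio i j S S   ≈⟨ solve 3 (λ w s r → w :* ((s :- s) :* r) := :0) refl (fromℕ (w i j)) (f i j S) _ ⟩
    0#                              ∎

  -- Submodularity for `T` and `S ∪ ⁅ x ⁆`, whose intersection contains `S`.
  gainTerm-subadditive : ∀ i j S {T T′} x → S ⊆ T → T′ ⊆ T ∪ ⁅ x ⁆ →
    gainTerm i j S T′ ≤ gainTerm i j S T + gainTerm i j S (S ∪ ⁅ x ⁆)
  gainTerm-subadditive i j S {T} {T′} x S⊆T T′⊆T∪x with unsat? i j S
  ... | no  _ = ≤-reflexive (sym (+-identityʳ 0#))
  ... | yes u = begin
    fromℕ (w i j) * ratio i j S T′
      ≤⟨ *-monoʳ-≤ (w-≥0 i j) (*-monoˡ-≤ (<⇒≤ (⁻¹-positive (0<y-x u))) increments) ⟩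
    fromℕ (w i j) * (((F T - F S) + (F X - F S)) * (1# - F S) ⁻¹)
      ≈⟨ solve 4 (λ w a b r → w :* ((a :+ b) :* r) :=
          w :* (a :* r) :+ w :* (b :* r)) refl (fromℕ (w i j)) (F T - F S) (F X - F S) _ ⟩
    fromℕ (w i j) * ratio i j S T + fromℕ (w i j) * ratio i j S X ∎
    where
    F = f i j
    X = S ∪ ⁅ x ⁆
    T′⊆T∪X : T′ ⊆ T ∪ X
    T′⊆T∪X y∈T′ with x∈p∪q⁻ _ _ (T′⊆T∪x y∈T′)
    ... | inj₁ y∈T = x∈p∪q⁺ (inj₁ y∈T)
    ... | inj₂ y∈x = x∈p∪q⁺ (inj₂ (x∈p∪q⁺ (inj₂ y∈x)))
    S⊆T∩X : S ⊆ T ∩ X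
    S⊆T∩X y∈S = x∈p∩q⁺ (S⊆T y∈S , x∈p∪q⁺ (inj₁ y∈S))
    increments : F T′ - F S ≤ (F T - F S) + (F X - F S)
    increments = begin
      F T′ - F S                           ≈⟨ solve 2 (λ t s → t :- s := (t :+ s) :- s :- s) refl (F T′) (F S) ⟩
      (F T′ + F S) - F S - F S             ≤⟨ +-monoˡ-≤ _ (+-monoˡ-≤ _ (+-mono-≤ (f-mono i j T′⊆T∪X) (f-mono i j S⊆T∩X))) ⟩
      (F (T ∪ X) + F (T ∩ X)) - F S - F S  ≤⟨ +-monoˡ-≤ _ (+-monoˡ-≤ _ (submodular (f-ms i j) T X)) ⟩
      (F T + F X) - F S - F S
        ≈⟨ solve 3 (λ t x s → (t :+ x) :- s :- s := (t :- s) :+ (x :- s)) refl (F T) (F X) (F S) ⟩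
      (F T - F S) + (F X - F S)            ∎

  -- A function unsatisfied at `S` but satisfied at `E` reaches 1 at `T`; its ratio is then 1 and
  -- its full weight is gained.
  gainTerm-cover : ∀ i j S {E T} → S ⊆ T → E ⊆ T →
    [ unsat? i j S ] fromℕ (w i j) ≤ gainTerm i j S T + [ unsat? i j E ] fromℕ (w i j)
  gainTerm-cover i j S {E} {T} S⊆T E⊆T with unsat? i j S | unsat? i j E
  ... | no  _ | no  _  = ≤-reflexive (sym (+-identityʳ 0#))
  ... | no  _ | yes _  = ≤-trans (w-≥0 i j) (≤-reflexive (sym (+-identityˡ _)))
  ... | yes u | yes _  = ≤-by _ (*-nonNeg (w-≥0 i j) (ratio-nonNeg i j u S⊆T)) (+-comm _ _)
  ... | yes u | no ¬uE = begin
    fromℕ (w i j)                          ≈⟨ *-identityʳ _ ⟨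
    fromℕ (w i j) * 1#                     ≤⟨ *-monoʳ-≤ (w-≥0 i j) (≤-/ (0<y-x u) (begin
        (1# - f i j S) * 1#                  ≈⟨ *-identityʳ _ ⟩
        1# - f i j S                         ≤⟨ +-monoˡ-≤ _ (≤-trans (≮⇒≥ ¬uE) (f-mono i j E⊆T)) ⟩
        f i j T - f i j S                    ∎)) ⟩
    fromℕ (w i j) * ratio i j S T          ≈⟨ +-identityʳ _ ⟨
    fromℕ (w i j) * ratio i j S T + 0#     ∎

  agentGain : Fin k → Subset n → Subset n → Carrier
  agentGain i S T = sum λ j → gainTerm i j S T

  -- score ℛ I A S e is definitionally gain A S (S ∪ ⁅ e ⁆).
  gain : Subset k → Subset n → Subset n → Carrier
  gain A S T = sumOver A λ i → agentGain i S T

  uW : Subset n → Fin k → ℕ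
  uW = unsatisfiedWeight ℛ I

  fromℕ-uW : ∀ S i → fromℕ (uW S i) ≈ sum (λ j → [ unsat? i j S ] fromℕ (w i j))
  fromℕ-uW S i = trans (fromℕ-sumℕ {m} _) (≤-antisym
      (sum-mono λ j → ≤-reflexive (term j (unsat? i j S))) (sum-mono λ j → ≤-reflexive (sym (term j (unsat? i j S)))))
    where
    term : ∀ j {P : Set} (d : Dec P) → fromℕ (if does d then w i j else 0) ≈ [ d ] fromℕ (w i j)
    term j (yes _) = refl
    term j (no  _) = refl

  uW-antitone : ∀ {S T} i → S ⊆ T → uW T i ℕ.≤ uW S i
  uW-antitone {S} {T} i S⊆T = sumℕ-mono {m} λ j → term j (unsat? i j T) (unsat? i j S)
    where
    term : ∀ j (t : Dec (Unsat i j T)) (s : Dec (Unsat i j S)) →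
           (if does t then w i j else 0) ℕ.≤ (if does s then w i j else 0)
    term j (yes _) (yes _) = ℕₚ.≤-refl
    term j (yes t) (no ¬s) = ⊥-elim (¬s (≤-<-trans (f-mono i j S⊆T) t))
    term j (no  _) _       = ℕ.z≤n

  agentGain-≥0 : ∀ i S {T} → S ⊆ T → 0# ≤ agentGain i S T
  agentGain-≥0 i S S⊆T = sum-nonNeg λ j → gainTerm-≥0 i j S S⊆T

  agentGain-cover : ∀ i S {E T} → S ⊆ T → E ⊆ T → fromℕ (uW S i) ≤ agentGain i S T + fromℕ (uW E i)
  agentGain-cover i S {E} {T} S⊆T E⊆T = begin
    fromℕ (uW S i)                                    ≈⟨ fromℕ-uW S i ⟩
    sum (λ j → [ unsat? i j S ] fromℕ (w i j))        ≤⟨ sum-mono-+ (λ j → gainTerm-cover i j S S⊆T E⊆T) ⟩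
    agentGain i S T + sum (λ j → [ unsat? i j E ] fromℕ (w i j)) ≈⟨ +-congˡ (fromℕ-uW E i) ⟨
    agentGain i S T + fromℕ (uW E i)                  ∎

  gain-mono : ∀ A S {T T′} → T ⊆ T′ → gain A S T ≤ gain A S T′
  gain-mono A S T⊆T′ = sumOver-mono A λ i _ → sum-mono λ j → gainTerm-mono i j S T⊆T′

  gain-≤0 : ∀ A S {T} → T ⊆ S → gain A S T ≤ 0#
  gain-≤0 A S {T} T⊆S = begin
    gain A S T
      ≤⟨ sumOver-mono A (λ i _ → ≤-trans (sum-mono λ j → gainTerm-≤0 i j S T⊆S) (≤-reflexive (sum-zero m))) ⟩
    sumOver A (λ _ → 0#)        ≈⟨ sumOver-const A 0# ⟩
    fromℕ ∣ A ∣ * 0#            ≈⟨ zeroʳ _ ⟩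
    0#                          ∎
    where
    sum-zero : ∀ l → sum {l} (λ _ → 0#) ≈ 0#
    sum-zero zero    = refl
    sum-zero (suc l) = trans (+-identityˡ _) (sum-zero l)

  gain-subadditive : ∀ A S {T T′} x → S ⊆ T → T′ ⊆ T ∪ ⁅ x ⁆ → gain A S T′ ≤ gain A S T + gain A S (S ∪ ⁅ x ⁆)
  gain-subadditive A S x S⊆T T′⊆ = ≤-trans
    (sumOver-mono A λ i _ → sum-mono-+ λ j → gainTerm-subadditive i j S x S⊆T T′⊆)
    (sumOver-+ A _ _)

  gain-prefix : ∀ A S μ → 0# ≤ μ → (∀ x → gain A S (S ∪ ⁅ x ⁆) ≤ μ) →
                ∀ σ l → gain A S (S ∪ prefix σ l) ≤ fromℕ l * μ
  gain-prefix A S μ 0≤μ gain≤μ σ zero = ≤-trans (gain-≤0 A S S∪∅⊆S) (≤-reflexive (sym (zeroˡ μ)))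
    where
    S∪∅⊆S : S ∪ prefix σ 0 ⊆ S
    S∪∅⊆S x∈ with x∈p∪q⁻ _ _ x∈
    ... | inj₁ x∈S = x∈S
    ... | inj₂ x∈∅ with ∈-prefix⁻ σ {0} x∈∅
    ...   | ()
  gain-prefix A S μ 0≤μ gain≤μ σ (suc l) with prefix-suc σ 0<n l
  ... | x , sub = begin
    gain A S (S ∪ prefix σ (suc l))                          ≤⟨ gain-subadditive A S x (p⊆p∪q _) ext ⟩
    gain A S (S ∪ prefix σ l) + gain A S (S ∪ ⁅ x ⁆)         ≤⟨ +-mono-≤ (gain-prefix A S μ 0≤μ gain≤μ σ l) (gain≤μ x) ⟩
    fromℕ l * μ + μ                                          ≈⟨ solve 2 (λ l m → l :* m :+ m := (:1 :+ l) :* m) refl (fromℕ l) μ ⟩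
    fromℕ (suc l) * μ                                        ∎
    where
    ext : S ∪ prefix σ (suc l) ⊆ (S ∪ prefix σ l) ∪ ⁅ x ⁆
    ext y∈ with x∈p∪q⁻ _ _ y∈
    ... | inj₁ y∈S = x∈p∪q⁺ (inj₁ (x∈p∪q⁺ (inj₁ y∈S)))
    ... | inj₂ y∈σ with x∈p∪q⁻ _ _ (sub y∈σ)
    ...   | inj₁ y∈σl = x∈p∪q⁺ (inj₁ (x∈p∪q⁺ (inj₂ y∈σl)))
    ...   | inj₂ y∈x  = x∈p∪q⁺ (inj₂ y∈x)

  greedy-prefix : ∀ {A S e} → IsGreedyChoice ℛ I A S e → ∀ σ l →
                  gain A S (S ∪ prefix σ l) ≤ fromℕ l * gain A S (S ∪ ⁅ e ⁆)
  greedy-prefix {A} {S} {e} (_ , best) = gain-prefix A S μ 0≤μ gain≤μ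
    where
    μ : Carrier
    μ = gain A S (S ∪ ⁅ e ⁆)
    0≤μ : 0# ≤ μ
    0≤μ = begin
      0#                          ≈⟨ zeroʳ _ ⟨
      fromℕ ∣ A ∣ * 0#            ≈⟨ sumOver-const A 0# ⟨
      sumOver A (λ _ → 0#)        ≤⟨ sumOver-mono A (λ i _ → agentGain-≥0 i S (p⊆p∪q _)) ⟩
      μ                           ∎
    gain≤μ : ∀ x → gain A S (S ∪ ⁅ x ⁆) ≤ μ
    gain≤μ x with x ∈? S
    ... | no x∉S = best x x∉S
    -- Elements of σ that are already selected are no candidates of the greedy rule, but they gain
    -- nothing either.
    ... | yes x∈S = ≤-trans (gain-≤0 A S absorbed) 0≤μ
      where
      absorbed : S ∪ ⁅ x ⁆ ⊆ S
      absorbed y∈ with x∈p∪q⁻ _ _ y∈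
      ... | inj₁ y∈S = y∈S
      ... | inj₂ y∈x with x∈⁅y⁆⇒x≡y _ y∈x
      ...   | ≡.refl = x∈S

  module _ {ε Λ : Carrier} (ε-min : IsMinNonzeroMarginal ℛ I ε) (pot : Potential ε Λ) where
    open Potential pot
    open IsMinNonzeroMarginal ε-min

    residual : Fin k → Fin m → Subset n → Carrier
    residual i j S = [ unsat? i j S ] (fromℕ (w i j) * φ (1# - f i j S))

    Φ : Subset k → Subset n → Carrier
    Φ A S = sumOver A λ i → sum λ j → residual i j S

    -- The deficit is itself a non-zero marginal, the one from `S` to the whole ground set.
    ε≤deficit : ∀ i j S → Unsat i j S → ε ≤ 1# - f i j S
    ε≤deficit i j S u = ≤-trans (lowerBound i j S ⊤ (⊆⊤ , <-≤-trans u (≤-reflexive (sym (f-full i j)))))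
      (≤-reflexive (+-congʳ (f-full i j)))

    ratio-φ : ∀ i j {S T} → Unsat i j S → S ⊆ T → ratio i j S T + φ (1# - f i j T) ≤ φ (1# - f i j S)
    ratio-φ i j {S} {T} uS S⊆T = begin
      ratio i j S T + φ (1# - f i j T)
        ≈⟨ +-congʳ (*-congʳ (solve 2 (λ s t → t :- s := (:1 :- s) :- (:1 :- t)) refl (f i j S) (f i j T))) ⟩
      ((1# - f i j S) - (1# - f i j T)) / (1# - f i j S) + φ (1# - f i j T)
        ≤⟨ φ-drop (ε≤deficit i j S uS) (≤-by (f i j S) (f-≥0 i j S) (solve 1 (λ s → :1 := (:1 :- s) :+ s) refl (f i j S)))
             (≤-by (f i j T - f i j S) (0≤y-x (f-mono i j S⊆T)) (solve 2 (λ s t → :1 :- s :=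
                 (:1 :- t) :+ (t :- s)) refl (f i j S) (f i j T))) ⟩
      φ (1# - f i j S) ∎

    φ-deficit-≥0 : ∀ i j S → 0# ≤ φ (1# - f i j S)
    φ-deficit-≥0 i j S = φ-≥0 (0≤y-x (f-≤1 i j S))

    gainTerm-residual : ∀ i j {S T} → S ⊆ T → gainTerm i j S T + residual i j T ≤ residual i j S
    gainTerm-residual i j {S} {T} S⊆T with unsat? i j S | unsat? i j T
    ... | no  _  | no  _  = ≤-reflexive (+-identityʳ 0#)
    ... | no ¬uS | yes uT = ⊥-elim (¬uS (≤-<-trans (f-mono i j S⊆T) uT))
    ... | yes uS | yes uT = begin
      fromℕ (w i j) * ratio i j S T + fromℕ (w i j) * φ (1# - f i j T) ≈⟨ distribˡ _ _ _ ⟨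
      fromℕ (w i j) * (ratio i j S T + φ (1# - f i j T))               ≤⟨ *-monoʳ-≤ (w-≥0 i j) (ratio-φ i j uS S⊆T) ⟩
      fromℕ (w i j) * φ (1# - f i j S)                                 ∎
    ... | yes uS | no  _ = begin
      fromℕ (w i j) * ratio i j S T + 0#   ≈⟨ +-identityʳ _ ⟩
      fromℕ (w i j) * ratio i j S T
        ≤⟨ *-monoʳ-≤ (w-≥0 i j) (≤-trans (≤-by _ (φ-deficit-≥0 i j T) refl) (ratio-φ i j uS S⊆T)) ⟩
      fromℕ (w i j) * φ (1# - f i j S)     ∎

    -- Makes the scores of an inner iteration telescope: with `Φ-≥0`, their sum is at most `Φ` at
    -- its start.
    gain-Φ : ∀ A {S T} → S ⊆ T → gain A S T + Φ A T ≤ Φ A S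
    gain-Φ A S⊆T = ≤-trans (sumOver-+′ A _ _)
      (sumOver-mono A λ i _ → sum-+-mono λ j → gainTerm-residual i j S⊆T)

    Φ-≥0 : ∀ A S → 0# ≤ Φ A S
    Φ-≥0 A S = begin
      0#                    ≈⟨ zeroʳ _ ⟨
      fromℕ ∣ A ∣ * 0#      ≈⟨ sumOver-const A 0# ⟨
      sumOver A (λ _ → 0#)  ≤⟨ sumOver-mono A (λ i _ → sum-nonNeg λ j → residual-≥0 i j) ⟩
      Φ A S                 ∎
      where
      residual-≥0 : ∀ i j → 0# ≤ residual i j S
      residual-≥0 i j with unsat? i j S
      ... | yes _ = *-nonNeg (w-≥0 i j) (φ-deficit-≥0 i j S)
      ... | no  _ = ≤-refl

    Φ-≤ : ∀ A S → Φ A S ≤ Λ * sumOver A (λ i → fromℕ (uW S i))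
    Φ-≤ A S = begin
      Φ A S                                                                       ≤⟨ sumOver-mono A (λ i _ → agent i) ⟩
      sumOver A (λ i → Λ * fromℕ (uW S i))                                        ≈⟨ sumOver-* A Λ (λ i → fromℕ (uW S i)) ⟩
      Λ * sumOver A (λ i → fromℕ (uW S i))                                        ∎
      where
      term : ∀ i j → residual i j S ≤ Λ * [ unsat? i j S ] fromℕ (w i j)
      term i j = begin
        [ unsat? i j S ] (fromℕ (w i j) * φ (1# - f i j S))
          ≤⟨ []-mono (unsat? i j S) (λ _ → ≤-trans (*-monoʳ-≤ (w-≥0 i j) (φ-≤ _)) (≤-reflexive (*-comm _ _))) ⟩
        [ unsat? i j S ] (Λ * fromℕ (w i j))                  ≈⟨ []-* (unsat? i j S) Λ (fromℕ (w i j)) ⟩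
        Λ * [ unsat? i j S ] fromℕ (w i j)                    ∎
      agent : ∀ i → sum (λ j → residual i j S) ≤ Λ * fromℕ (uW S i)
      agent i = begin
        sum (λ j → residual i j S)                         ≤⟨ sum-mono (term i) ⟩
        sum (λ j → Λ * [ unsat? i j S ] fromℕ (w i j))     ≈⟨ *-distribˡ-sum Λ (λ j → [ unsat? i j S ] fromℕ (w i j)) ⟨
        Λ * sum (λ j → [ unsat? i j S ] fromℕ (w i j))     ≈⟨ *-congˡ (fromℕ-uW S i) ⟨
        Λ * fromℕ (uW S i)                                 ∎

-- Thresholds, heavy agents and cover times.

module CoverTime (ℛ : Reals) {n k m : ℕ} (I : SRMA ℛ n k m) where

  open Reals ℛ hiding (zero)
  open OrderedField ℛ
  open Logarithm ℛ
  open LogPotential ℛ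
  open Gain ℛ I
  open Reasoning
  open SRMA I

  W′ : ℕ
  W′ = W ℛ I

  H : ℕ → Subset n → Subset k
  H = heavy ℛ I

  B : ℕ → Carrier
  B p = fromℕ (2 ℕ.^ p ℕ.* W′) / fromℕ (3 ℕ.^ p)

  agentWeight≤W : ∀ i → sumℕ (w i) ℕ.≤ W′
  agentWeight≤W = ≤-maxℕ (λ i → sumℕ (w i))

  1≤W : 1 ℕ.≤ W′
  1≤W = ℕₚ.≤-trans (1≤w (fromℕ< 0<k) (fromℕ< 0<m))
    (ℕₚ.≤-trans (sumℕ-≤-term (w (fromℕ< 0<k)) (fromℕ< 0<m)) (agentWeight≤W (fromℕ< 0<k)))

  3^p-pos : ∀ p → 0# < fromℕ (3 ℕ.^ p)
  3^p-pos p = fromℕ-pos (ℕₚ.m^n>0 3 p)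

  3^p*B : ∀ p → fromℕ (3 ℕ.^ p) * B p ≈ fromℕ (2 ℕ.^ p ℕ.* W′)
  3^p*B p = y*[x/y]≈x (3^p-pos p)

  B-pos : ∀ p → 0# < B p
  B-pos p = *-positive (fromℕ-pos (ℕₚ.*-mono-≤ (ℕₚ.m^n>0 2 p) 1≤W)) (⁻¹-positive (3^p-pos p))

  B≤W : ∀ p → B p ≤ fromℕ W′
  B≤W p = /-≤ (3^p-pos p) (≤-trans (fromℕ-mono-≤ (ℕₚ.*-monoˡ-≤ W′ (ℕₚ.^-monoˡ-≤ p (ℕ.s≤s (ℕ.s≤s (ℕ.z≤n {1}))))))
    (≤-reflexive (fromℕ-* (3 ℕ.^ p) W′)))

  B-suc : ∀ p → fromℕ 2 * B p ≈ fromℕ 3 * B (suc p)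
  B-suc p = ≈-cancelˡ (3^p-pos p) (begin-equality
    y * (fromℕ 2 * B p)               ≈⟨ solve 3 (λ y t b → y :* (t :* b) := t :* (y :* b)) refl y (fromℕ 2) (B p) ⟩
    fromℕ 2 * (y * B p)               ≈⟨ *-congˡ (3^p*B p) ⟩
    fromℕ 2 * fromℕ (2 ℕ.^ p ℕ.* W′)  ≈⟨ fromℕ-* 2 (2 ℕ.^ p ℕ.* W′) ⟨
    fromℕ (2 ℕ.* (2 ℕ.^ p ℕ.* W′))    ≡⟨ ≡.cong fromℕ (≡.sym (ℕₚ.*-assoc 2 (2 ℕ.^ p) W′)) ⟩
    fromℕ (2 ℕ.^ suc p ℕ.* W′)        ≈⟨ 3^p*B (suc p) ⟨
    fromℕ (3 ℕ.* 3 ℕ.^ p) * B (suc p) ≈⟨ *-congʳ (fromℕ-* 3 (3 ℕ.^ p)) ⟩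
    fromℕ 3 * y * B (suc p)           ≈⟨ solve 3 (λ y t b → t :* y :* b := y :* (t :* b)) refl y (fromℕ 3) (B (suc p)) ⟩
    y * (fromℕ 3 * B (suc p))         ∎)
    where y = fromℕ (3 ℕ.^ p)

  heavy? : ∀ p S i → Dec (2 ℕ.^ p ℕ.* W′ ℕ.< 3 ℕ.^ p ℕ.* uW S i)
  heavy? p S i = 2 ℕ.^ p ℕ.* W′ ℕₚ.<? 3 ℕ.^ p ℕ.* uW S i

  heavy-> : ∀ p S {i} → i ∈ H p S → B p < fromℕ (uW S i)
  heavy-> p S {i} i∈ = *-cancelˡ-< (<⇒≤ (3^p-pos p)) (begin-strict
    fromℕ (3 ℕ.^ p) * B p              ≈⟨ 3^p*B p ⟩
    fromℕ (2 ℕ.^ p ℕ.* W′)             <⟨ fromℕ-mono-< (∈-tabulate⁻ (heavy? p S) i∈) ⟩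
    fromℕ (3 ℕ.^ p ℕ.* uW S i)         ≈⟨ fromℕ-* (3 ℕ.^ p) (uW S i) ⟩
    fromℕ (3 ℕ.^ p) * fromℕ (uW S i)   ∎)

  light-≤ℕ : ∀ p S → ¬ Nonempty (H p S) → ∀ i → 3 ℕ.^ p ℕ.* uW S i ℕ.≤ 2 ℕ.^ p ℕ.* W′
  light-≤ℕ p S light i = ℕₚ.≮⇒≥ λ h → light (i , ∈-tabulate⁺ (heavy? p S) h)

  light-≤ : ∀ p S → ¬ Nonempty (H p S) → ∀ i → fromℕ (uW S i) ≤ B p
  light-≤ p S light i = ≤-/ (3^p-pos p) (≤-trans (≤-reflexive (sym (fromℕ-* (3 ℕ.^ p) (uW S i)))) (fromℕ-mono-≤ (light-≤ℕ p S light i)))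

  heavy-antitone : ∀ p {S T} → S ⊆ T → H p T ⊆ H p S
  heavy-antitone p {S} {T} S⊆T {i} i∈ = ∈-tabulate⁺ (heavy? p S)
    (ℕₚ.<-≤-trans (∈-tabulate⁻ (heavy? p T) i∈) (ℕₚ.*-monoʳ-≤ (3 ℕ.^ p) (uW-antitone i S⊆T)))

  light-mono : ∀ p {S T} → S ⊆ T → ¬ Nonempty (H p S) → ¬ Nonempty (H p T)
  light-mono p S⊆T light (i , i∈) = light (i , heavy-antitone p S⊆T i∈)

  uW≤agentWeight : ∀ S i → uW S i ℕ.≤ sumℕ (w i)
  uW≤agentWeight S i = sumℕ-mono {m} λ j → term j (unsat? i j S)
    where
    term : ∀ j {P : Set} (d : Dec P) → (if does d then w i j else 0) ℕ.≤ w i j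
    term j (yes _) = ℕₚ.≤-refl
    term j (no  _) = ℕ.z≤n

  -- As B_0 = W, the state before phase 1 looks like the end of a phase 0, and phase 1 needs no
  -- separate treatment.
  light-0 : ∀ S → ¬ Nonempty (H 0 S)
  light-0 S (i , i∈) = ℕₚ.<⇒≱ (∈-tabulate⁻ (heavy? 0 S) i∈)
    (ℕₚ.+-monoˡ-≤ 0 (ℕₚ.≤-trans (uW≤agentWeight S i) (agentWeight≤W i)))

  nonempty⇒1≤∣∣ : ∀ {l} {A : Subset l} → Nonempty A → 1 ℕ.≤ ∣ A ∣
  nonempty⇒1≤∣∣ {A = A} (x , x∈A) = ≡.subst (ℕ._≤ ∣ A ∣) (∣⁅x⁆∣≡1 x) (p⊆q⇒∣p∣≤∣q∣ {q = A} λ y∈ → ≡.subst (_∈ A) (≡.sym (x∈⁅y⁆⇒x≡y x y∈)) x∈A)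

  empty⇒∣∣≡0 : ∀ {l} {A : Subset l} → ¬ Nonempty A → ∣ A ∣ ≡ 0
  empty⇒∣∣≡0 {l} empty = ≡.trans (≡.cong ∣_∣ (Empty-unique empty)) (∣⊥∣≡0 l)

  module Cover (π : Permutation′ n) (i : Fin k) (j : Fin m) where

    c : ℕ
    c = cov ℛ I (f i j) π

    Sat : ℕ → Set
    Sat t = f i j (prefix π t) ≈ 1#

    sat? : ∀ t → Dec (Sat t)
    sat? t = f i j (prefix π t) ≟ 1#

    1+[n∸1]≡n : 1 ℕ.+ (n ℕ.∸ 1) ≡ n
    1+[n∸1]≡n = ℕₚ.m+[n∸m]≡n 0<n

    1≤cov : 1 ℕ.≤ c
    1≤cov = firstFrom-≥ sat? 1 (n ℕ.∸ 1)

    cov≤n : c ℕ.≤ n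
    cov≤n = ≡.subst (c ℕ.≤_) 1+[n∸1]≡n (firstFrom-≤-max sat? 1 (n ℕ.∸ 1))

    sat-cov : Sat c
    sat-cov = firstFrom-sat sat? 1 (n ℕ.∸ 1) (≡.subst Sat (≡.sym 1+[n∸1]≡n) (f-top i j (⊤⊆prefix π)))

    sat-mono : ∀ {s t} → s ℕ.≤ t → Sat s → Sat t
    sat-mono {s} {t} s≤t Ps = ≤-antisym (f-≤1 i j _) (≤-trans (≤-reflexive (sym Ps)) (f-mono i j (prefix-mono π s≤t)))

    -- The search for the cover time starts at 1, so at s = 0 only the decremented value can be
    -- bounded by s.
    sat⇒cov≤ : ∀ s → Sat s → c ℕ.∸ 1 ℕ.≤ s
    sat⇒cov≤ s Ps = ℕₚ.∸-monoˡ-≤ 1 (firstFrom-≤ sat? 1 (n ℕ.∸ 1) {suc s} (sat-mono (ℕₚ.n≤1+n s) Ps) (ℕ.s≤s ℕ.z≤n))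

    unsat⇒≤cov : ∀ l → Unsat i j (prefix π l) → l ℕ.≤ c
    unsat⇒≤cov l u = ℕₚ.≮⇒≥ λ c<l → ≤⇒≯ (≤-reflexive (sym (sat-mono (ℕₚ.<⇒≤ c<l) sat-cov))) u

  agentCost : Permutation′ n → Fin k → ℕ
  agentCost π i = sumℕ λ j → w i j ℕ.* cov ℛ I (f i j) π

  agentCost≤objective : ∀ π i → agentCost π i ℕ.≤ objective ℛ I π
  agentCost≤objective π = ≤-maxℕ (agentCost π)

  -- Markov's inequality for cover times: every function still unsatisfied after `l` elements has
  -- cover time at least `l`.
  l*uW≤objective : ∀ σ l i → l ℕ.* uW (prefix σ l) i ℕ.≤ objective ℛ I σ
  l*uW≤objective σ l i = ℕₚ.≤-trans
    (ℕₚ.≤-trans (ℕₚ.≤-reflexive (≡.sym (sumℕ-* {m} l _))) (sumℕ-mono {m} λ j → term j (unsat? i j (prefix σ l))))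
    (agentCost≤objective σ i)
    where
    term : ∀ j (d : Dec (Unsat i j (prefix σ l))) → l ℕ.* (if does d then w i j else 0) ℕ.≤ w i j ℕ.* cov ℛ I (f i j) σ
    term j (yes u) = ℕₚ.≤-trans (ℕₚ.≤-reflexive (ℕₚ.*-comm l (w i j))) (ℕₚ.*-monoʳ-≤ (w i j) (Cover.unsat⇒≤cov σ i j l u))
    term j (no  _) = ℕₚ.≤-trans (ℕₚ.≤-reflexive (ℕₚ.*-zeroʳ l)) ℕ.z≤n

  W≤objective : ∀ σ → W′ ℕ.≤ objective ℛ I σ
  W≤objective σ = maxℕ-induction (ℕ._≤ objective ℛ I σ) ℕ.z≤n (λ i → sumℕ (w i)) λ i →
    ℕₚ.≤-trans (sumℕ-mono λ j → ≡.subst (ℕ._≤ w i j ℕ.* cov ℛ I (f i j) σ) (ℕₚ.*-identityʳ (w i j))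
        (ℕₚ.*-monoʳ-≤ (w i j) (Cover.1≤cov σ i j)))
               (agentCost≤objective σ i)

  -- The cost agent i still has to pay after s selections.  One unit per function
  -- is left out, since a cover time is at least 1 even for a function with f ∅ = 1.
  remaining : Permutation′ n → Fin k → ℕ → ℕ
  remaining π i s = sumℕ λ j → w i j ℕ.* ((cov ℛ I (f i j) π ℕ.∸ 1) ℕ.∸ s)

  module _ (π : Permutation′ n) (i : Fin k) where

    private
      c : Fin m → ℕ
      c j = cov ℛ I (f i j) π

      satisfied : ∀ j s → ¬ Unsat i j (prefix π s) → c j ℕ.∸ 1 ℕ.∸ s ≡ 0
      satisfied j s ¬u = ℕₚ.m≤n⇒m∸n≡0 (Cover.sat⇒cov≤ π i j s (≤-antisym (f-≤1 i j _) (≮⇒≥ ¬u)))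

      -- Functions satisfied by time `s` have nothing left to pay, so the excess `d` is charged only
      -- to the weight unsatisfied at `s`.
      weigh : ∀ s d (r : Fin m → ℕ) →
        (∀ j → Unsat i j (prefix π s) → c j ℕ.∸ 1 ℕ.∸ s ℕ.≤ r j ℕ.+ d) →
        remaining π i s ℕ.≤ sumℕ (λ j → w i j ℕ.* r j) ℕ.+ d ℕ.* uW (prefix π s) i
      weigh s d r bound = ℕₚ.≤-trans (sumℕ-mono {m} λ j → term j (unsat? i j (prefix π s)))
        (ℕₚ.≤-reflexive (≡.trans (sumℕ-+ {m} (λ j → w i j ℕ.* r j) _) (≡.cong (sumℕ (λ j → w i j ℕ.* r j) ℕ.+_) (sumℕ-* {m} d _))))
        where
        term : ∀ j (u : Dec (Unsat i j (prefix π s))) →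
          w i j ℕ.* (c j ℕ.∸ 1 ℕ.∸ s) ℕ.≤ w i j ℕ.* r j ℕ.+ d ℕ.* (if does u then w i j else 0)
        term j (yes u) = ℕₚ.≤-trans (ℕₚ.*-monoʳ-≤ (w i j) (bound j u))
          (ℕₚ.≤-reflexive (≡.trans (ℕₚ.*-distribˡ-+ (w i j) (r j) d) (≡.cong (w i j ℕ.* r j ℕ.+_) (ℕₚ.*-comm (w i j) d))))
        term j (no ¬u) = ℕₚ.≤-trans (ℕₚ.≤-reflexive (≡.trans (≡.cong (w i j ℕ.*_) (satisfied j s ¬u)) (ℕₚ.*-zeroʳ (w i j)))) ℕ.z≤n

    -- Each of the next `d` selections costs the current unsatisfied weight, which is largest at
    -- `s`.
    remaining-step : ∀ d s → remaining π i s ℕ.≤ remaining π i (d ℕ.+ s) ℕ.+ d ℕ.* uW (prefix π s) i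
    remaining-step d s = weigh s d (λ j → c j ℕ.∸ 1 ℕ.∸ (d ℕ.+ s)) λ j _ → split (c j ℕ.∸ 1)
      where
      split : ∀ a → a ℕ.∸ s ℕ.≤ (a ℕ.∸ (d ℕ.+ s)) ℕ.+ d
      split a = ≡.subst (λ b → a ℕ.∸ s ℕ.≤ b ℕ.+ d) (≡.trans (ℕₚ.∸-+-assoc a s d) (≡.cong (a ℕ.∸_) (ℕₚ.+-comm s d)))
        (≡.subst (a ℕ.∸ s ℕ.≤_) (ℕₚ.+-comm d _) (ℕₚ.m≤n+m∸n (a ℕ.∸ s) d))

    remaining-≤-n : ∀ s → remaining π i s ℕ.≤ n ℕ.* uW (prefix π s) i
    remaining-≤-n s = ℕₚ.≤-trans (weigh s n (λ _ → 0) λ j _ →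
        ℕₚ.≤-trans (ℕₚ.m∸n≤m (c j ℕ.∸ 1) s) (ℕₚ.≤-trans (ℕₚ.m∸n≤m (c j) 1) (Cover.cov≤n π i j)))
      (ℕₚ.≤-reflexive (≡.cong (ℕ._+ n ℕ.* uW (prefix π s) i) zeros))
      where
      zeros : sumℕ (λ j → w i j ℕ.* 0) ≡ 0
      zeros = sumℕ-zero λ j → ℕₚ.*-zeroʳ (w i j)

    agentCost-≤ : agentCost π i ℕ.≤ remaining π i 0 ℕ.+ sumℕ (w i)
    agentCost-≤ = ℕₚ.≤-trans (sumℕ-mono λ j → ℕₚ.≤-trans (ℕₚ.*-monoʳ-≤ (w i j) (ℕₚ.m≤n+m∸n (c j) 1))
        (ℕₚ.≤-reflexive (shift (w i j) (c j ℕ.∸ 1))))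
      (ℕₚ.≤-reflexive (sumℕ-+ (λ j → w i j ℕ.* (c j ℕ.∸ 1)) (w i)))
      where
      shift : ∀ a b → a ℕ.* (1 ℕ.+ b) ≡ a ℕ.* b ℕ.+ a
      shift a b = ≡.trans (ℕₚ.*-suc a b) (ℕₚ.+-comm a _)

    remaining≡0 : ∀ s → AllSatisfied ℛ I (prefix π s) → remaining π i s ≡ 0
    remaining≡0 s sat = sumℕ-zero λ j → ≡.trans
      (≡.cong (w i j ℕ.*_) (satisfied j s (≤⇒≯ (≤-reflexive (sym (sat i j)))))) (ℕₚ.*-zeroʳ (w i j))

-- Length and cost of inner iterations and of phases.

module Phases (ℛ : Reals) {n k m : ℕ} (I : SRMA ℛ n k m) where

  open Reals ℛ hiding (zero)
  open OrderedField ℛ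
  open Logarithm ℛ
  open LogPotential ℛ
  open Gain ℛ I
  open CoverTime ℛ I
  open Reasoning
  open SRMA I

  private
    c2 c3 : Carrier
    c2 = fromℕ 2
    c3 = fromℕ 3

    0<c2 : 0# < c2
    0<c2 = fromℕ-suc-pos 1

    0<c3 : 0# < c3
    0<c3 = fromℕ-suc-pos 2

    c4≈c2*c2 : fromℕ 4 ≈ c2 * c2
    c4≈c2*c2 = fromℕ-* 2 2

  module Iterations
    {ε Λ : Carrier} (ε-min : IsMinNonzeroMarginal ℛ I ε) (pot : Potential ε Λ)
    (π σ : Permutation′ n) where

    0≤Λ : 0# ≤ Λ
    0≤Λ = ≤-trans (Potential.φ-≥0 pot ≤-refl) (Potential.φ-≤ pot 0#)

    opt : ℕ
    opt = objective ℛ I σ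

    o : Carrier
    o = fromℕ opt

    0<o : 0# < o
    0<o = fromℕ-pos (ℕₚ.≤-trans 1≤W (W≤objective σ))

    module Phase (p L : ℕ) (2o≤LB : c2 * o ≤ fromℕ L * B p) where

      b ℓ : Carrier
      b = B p
      ℓ = fromℕ L

      0<ℓ : 0# < ℓ
      0<ℓ = ≰⇒> λ ℓ≤0 → ≤⇒≯
        (≤-trans 2o≤LB (≤-trans (*-monoˡ-≤ (<⇒≤ (B-pos p)) ℓ≤0) (≤-reflexive (zeroˡ b)))) (*-positive 0<c2 0<o)

      half : ∀ S i → i ∈ H p S → b ≤ c2 * agentGain i S (S ∪ prefix σ L)
      half S i i∈H = combine _ _ _ (agentGain-cover i S (p⊆p∪q (prefix σ L)) (q⊆p∪q S (prefix σ L))) (<⇒≤ (heavy-> p S i∈H))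
        (*-cancelˡ-≤ 0<ℓ (begin
          ℓ * (c2 * fromℕ e)      ≈⟨ solve 3 (λ l c e → l :* (c :* e) := c :* (l :* e)) refl ℓ c2 (fromℕ e) ⟩
          c2 * (ℓ * fromℕ e)      ≈⟨ *-congˡ (fromℕ-* L e) ⟨
          c2 * fromℕ (L ℕ.* e)    ≤⟨ *-monoʳ-≤ (<⇒≤ 0<c2) (fromℕ-mono-≤ (l*uW≤objective σ L i)) ⟩
          c2 * o                  ≤⟨ 2o≤LB ⟩
          ℓ * b                   ∎))
        where
        e : ℕ
        e = uW (prefix σ L) i
        combine : ∀ u g e′ → u ≤ g + e′ → b ≤ u → c2 * e′ ≤ b → b ≤ c2 * g
        combine u g e′ u≤g+e b≤u 2e≤b = ≤-by (c2 * (g + e′ - u) + c2 * (u - b) + (b - c2 * e′))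
          (+-nonNeg (+-nonNeg (*-nonNeg (<⇒≤ 0<c2) (0≤y-x u≤g+e)) (*-nonNeg (<⇒≤ 0<c2) (0≤y-x b≤u))) (0≤y-x 2e≤b))
          (solve 4 (λ u g e b → two′ :* g := b :+ (two′ :* (g :+ e :- u) :+ two′ :* (u :- b) :+ (b :- two′ :* e))) refl u g e′ b)
          where
          two′ : ∀ {l} → Polynomial l
          two′ = :1 :+ (:1 :+ :0)

      -- Denominators are cleared: the greedy score is at least (3/4) |A| B / (2 L), which is
      -- `quota A` divided by 8 ℓ.
      quota : Subset k → Carrier
      quota A = c3 * fromℕ ∣ A ∣ * b

      greedy-step : ∀ {A S e} → IsGreedyChoice ℛ I A S e → H p S ⊆ A → 3 ℕ.* ∣ A ∣ ℕ.≤ 4 ℕ.* ∣ H p S ∣ →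
                    quota A ≤ c2 * c2 * c2 * ℓ * gain A S (S ∪ ⁅ e ⁆)
      greedy-step {A} {S} {e} greedy H⊆A 3A≤4H = begin
        c3 * fromℕ ∣ A ∣ * b             ≈⟨ *-congʳ (fromℕ-* 3 ∣ A ∣) ⟨
        fromℕ (3 ℕ.* ∣ A ∣) * b          ≤⟨ *-monoˡ-≤ (<⇒≤ (B-pos p)) (fromℕ-mono-≤ 3A≤4H) ⟩
        fromℕ (4 ℕ.* ∣ H p S ∣) * b      ≈⟨ *-congʳ (trans (fromℕ-* 4 ∣ H p S ∣) (*-congʳ c4≈c2*c2)) ⟩
        c2 * c2 * fromℕ ∣ H p S ∣ * b    ≈⟨ *-assoc _ _ _ ⟩
        c2 * c2 * (fromℕ ∣ H p S ∣ * b)  ≤⟨ *-monoʳ-≤ (<⇒≤ (*-positive 0<c2 0<c2)) heavy-gain ⟩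
        c2 * c2 * (c2 * (ℓ * μ))         ≈⟨ solve 3 (λ c l m → c :* c :* (c :* (l :* m)) := c :* c :* c :* l :* m) refl c2 ℓ μ ⟩
        c2 * c2 * c2 * ℓ * μ             ∎
        where
        μ : Carrier
        μ = gain A S (S ∪ ⁅ e ⁆)
        T : Subset n
        T = S ∪ prefix σ L
        heavy-gain : fromℕ ∣ H p S ∣ * b ≤ c2 * (ℓ * μ)
        heavy-gain = begin
          fromℕ ∣ H p S ∣ * b                              ≈⟨ sumOver-const (H p S) b ⟨
          sumOver (H p S) (λ _ → b)                        ≤⟨ sumOver-mono (H p S) (half S) ⟩
          sumOver (H p S) (λ i → c2 * agentGain i S T)     ≈⟨ sumOver-* (H p S) c2 (λ i → agentGain i S T) ⟩
          c2 * sumOver (H p S) (λ i → agentGain i S T)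
            ≤⟨ *-monoʳ-≤ (<⇒≤ 0<c2) (sumOver-⊆ H⊆A (λ i → agentGain-≥0 i S (p⊆p∪q (prefix σ L)))) ⟩
          c2 * gain A S T                                  ≤⟨ *-monoʳ-≤ (<⇒≤ 0<c2) (greedy-prefix greedy σ L) ⟩
          c2 * (ℓ * μ)                                     ∎

      -- Each selection takes at least `quota A` out of 8 ℓ `Φ`. `A` stays fixed while the heavy
      -- agents shrink inside it, hence the inclusion as invariant; `Continue` keeps enough of them
      -- for `greedy-step`.
      inner : ∀ {A s s′} → Inner ℛ I π p A s s′ → H p (prefix π s) ⊆ A →
              ∃[ d ] s′ ≡ d ℕ.+ s × fromℕ d * quota A ≤ c2 * c2 * c2 * ℓ * Φ ε-min pot A (prefix π s)
      inner {A} {s} (stop _) H⊆A = 0 , ≡.refl , (begin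
        0# * quota A                                          ≈⟨ zeroˡ _ ⟩
        0#
          ≤⟨ *-nonNeg (*-nonNeg (<⇒≤ (*-positive (*-positive 0<c2 0<c2) 0<c2)) (<⇒≤ 0<ℓ)) (Φ-≥0 ε-min pot A _) ⟩
        c2 * c2 * c2 * ℓ * Φ ε-min pot A (prefix π s)         ∎)
      inner {A} {s} (select (3A≤4H , _) t ≡.refl greedy rest) H⊆A
        with inner rest (λ i∈ → H⊆A (heavy-antitone p (prefix-mono π (ℕₚ.n≤1+n _)) i∈))
      ... | d , s′≡d+1+s , dq≤ = suc d , ≡.trans s′≡d+1+s (ℕₚ.+-suc d _) , (begin
        (1# + fromℕ d) * quota A                              ≈⟨ trans (distribʳ _ _ _) (+-congʳ (*-identityˡ _)) ⟩
        quota A + fromℕ d * quota A                           ≤⟨ +-mono-≤ (greedy-step greedy H⊆A 3A≤4H) dq≤ ⟩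
        c * gain A S (S ∪ ⁅ e ⁆) + c * Φ ε-min pot A S′       ≈⟨ distribˡ c _ _ ⟨
        c * (gain A S (S ∪ ⁅ e ⁆) + Φ ε-min pot A S′)         ≤⟨ *-monoʳ-≤ 0≤c (+-monoˡ-≤ _ (gain-mono A S (prefix-add π t))) ⟩
        c * (gain A S S′ + Φ ε-min pot A S′)                  ≤⟨ *-monoʳ-≤ 0≤c (gain-Φ ε-min pot A (prefix-mono π (ℕₚ.n≤1+n _))) ⟩
        c * Φ ε-min pot A S                                   ∎)
        where
        c : Carrier
        c = c2 * c2 * c2 * ℓ
        0≤c : 0# ≤ c
        0≤c = *-nonNeg (<⇒≤ (*-positive (*-positive 0<c2 0<c2) 0<c2)) (<⇒≤ 0<ℓ)
        e : Fin n
        e = π ⟨$⟩ʳ t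
        S S′ : Subset n
        S = prefix π (toℕ t)
        S′ = prefix π (suc (toℕ t))

    inner-stops : ∀ {p A s s′} → Inner ℛ I π p A s s′ → ¬ Continue ℛ I π p A s′
    inner-stops (stop ¬continue)      = ¬continue
    inner-stops (select _ _ _ _ rest) = inner-stops rest

    module _ (p L : ℕ) (2o≤LB : c2 * o ≤ fromℕ L * B (suc p)) where

      open Phase (suc p) L 2o≤LB

      -- From d · 3 |A| B_{p+1} ≤ 8 ℓ Λ |A| B_p and 2 B_p = 3 B_{p+1} there follows d ≤ 4 ℓ Λ.
      δ : Carrier
      δ = c2 * c2 * ℓ * Λ

      inner-length : ∀ {s s′} → ¬ Nonempty (H p (prefix π s)) → Nonempty (H (suc p) (prefix π s)) →
                     Inner ℛ I π (suc p) (H (suc p) (prefix π s)) s s′ →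
                     ∃[ d ] s′ ≡ d ℕ.+ s × fromℕ d ≤ δ
      inner-length {s} light nonempty run with inner run (λ i∈ → i∈)
      ... | d , s′≡d+s , dq≤ = d , s′≡d+s , *-cancelˡ-≤ 0<q (begin
        quota A * fromℕ d                                   ≈⟨ *-comm _ _ ⟩
        fromℕ d * quota A                                   ≤⟨ dq≤ ⟩
        c * Φ ε-min pot A S                                 ≤⟨ *-monoʳ-≤ 0≤c (Φ-≤ ε-min pot A S) ⟩
        c * (Λ * sumOver A (λ i → fromℕ (uW S i)))
          ≤⟨ *-monoʳ-≤ 0≤c (*-monoʳ-≤ 0≤Λ (sumOver-mono A λ i _ → light-≤ p S light i)) ⟩
        c * (Λ * sumOver A (λ i → B p))                     ≈⟨ *-congˡ (*-congˡ (sumOver-const A (B p))) ⟩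
        c * (Λ * (fromℕ ∣ A ∣ * B p))
          ≈⟨ solve 5 (λ c l λ′ a b → c :* c :* c :* l :* (λ′ :* (a :* b)) :=
              a :* (c :* b) :* (c :* c :* l :* λ′)) refl c2 ℓ Λ (fromℕ ∣ A ∣) (B p) ⟩
        fromℕ ∣ A ∣ * (c2 * B p) * δ                        ≈⟨ *-congʳ (*-congˡ (B-suc p)) ⟩
        fromℕ ∣ A ∣ * (c3 * b) * δ
          ≈⟨ *-congʳ (solve 3 (λ a c b → a :* (c :* b) := c :* a :* b) refl (fromℕ ∣ A ∣) c3 b) ⟩
        quota A * δ                                         ∎)
        where
        S : Subset n
        S = prefix π s
        A : Subset k
        A = H (suc p) S
        c : Carrier
        c = c2 * c2 * c2 * ℓ
        0≤c : 0# ≤ c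
        0≤c = *-nonNeg (<⇒≤ (*-positive (*-positive 0<c2 0<c2) 0<c2)) (<⇒≤ 0<ℓ)
        0<q : 0# < quota A
        0<q = *-positive (*-positive 0<c3 (fromℕ-pos (nonempty⇒1≤∣∣ nonempty))) (B-pos (suc p))

      shrink : ∀ a h K → 4 ℕ.* h ℕ.≤ 3 ℕ.* a → a ℕ.* 3 ℕ.^ suc K ℕ.< 4 ℕ.^ suc K → h ℕ.* 3 ℕ.^ K ℕ.< 4 ℕ.^ K
      shrink a h K 4h≤3a a3<4 = ℕₚ.*-cancelˡ-< 4 _ _ (ℕₚ.≤-<-trans
        (ℕₚ.≤-trans (ℕₚ.≤-reflexive (≡.sym (ℕₚ.*-assoc 4 h (3 ℕ.^ K))))
          (ℕₚ.≤-trans (ℕₚ.*-monoˡ-≤ (3 ℕ.^ K) 4h≤3a)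
            (ℕₚ.≤-reflexive (≡.trans (≡.cong (ℕ._* 3 ℕ.^ K) (ℕₚ.*-comm 3 a)) (ℕₚ.*-assoc a 3 (3 ℕ.^ K))))))
        a3<4)

      Shortened : ℕ → ℕ → ℕ → Set
      Shortened s s′ K = ∃[ d ] s′ ≡ d ℕ.+ s × fromℕ d ≤ fromℕ K * δ × ¬ Nonempty (H (suc p) (prefix π s′))

      -- The number of heavy agents is below (4/3)^K. For K = 0 none is left, which ends the
      -- recursion of `outer`.
      Few : ℕ → ℕ → Set
      Few s K = ∣ H (suc p) (prefix π s) ∣ ℕ.* 3 ℕ.^ K ℕ.< 4 ℕ.^ K

      -- `Continue` fails in one of two ways: more than a quarter of the agents has been lost, or no
      -- heavy agent is left.
      few-suc : ∀ s s′ K → ¬ Continue ℛ I π (suc p) (H (suc p) (prefix π s)) s′ → Few s (suc K) → Few s′ K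
      few-suc s s′ K stopped few = by-cases (3 ℕ.* ∣ H (suc p) (prefix π s) ∣ ℕₚ.≤? 4 ℕ.* ∣ H (suc p) (prefix π s′) ∣)
        where
        by-cases : Dec (3 ℕ.* ∣ H (suc p) (prefix π s) ∣ ℕ.≤ 4 ℕ.* ∣ H (suc p) (prefix π s′) ∣) → Few s′ K
        by-cases (no 3a≰4h)  = shrink ∣ H (suc p) (prefix π s) ∣ ∣ H (suc p) (prefix π s′) ∣ K (ℕₚ.<⇒≤ (ℕₚ.≰⇒> 3a≰4h)) few
        by-cases (yes 3a≤4h) = ≡.subst (λ h → h ℕ.* 3 ℕ.^ K ℕ.< 4 ℕ.^ K)
          (≡.sym (empty⇒∣∣≡0 λ nonempty′ → stopped (3a≤4h , nonempty′))) (ℕₚ.m^n>0 4 K)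

      append : ∀ {s s₁ s″} K → (∃[ d ] s₁ ≡ d ℕ.+ s × fromℕ d ≤ δ) → Shortened s₁ s″ K → Shortened s s″ (suc K)
      append {s} K (d₁ , s₁≡ , d₁≤δ) (d₂ , s″≡ , d₂≤Kδ , empty) =
        d₂ ℕ.+ d₁ , ≡.trans s″≡ (≡.trans (≡.cong (d₂ ℕ.+_) s₁≡) (≡.sym (ℕₚ.+-assoc d₂ d₁ s))) , (begin
        fromℕ (d₂ ℕ.+ d₁)        ≈⟨ fromℕ-+ d₂ d₁ ⟩
        fromℕ d₂ + fromℕ d₁      ≤⟨ +-mono-≤ d₂≤Kδ d₁≤δ ⟩
        fromℕ K * δ + δ          ≈⟨ solve 2 (λ k d → k :* d :+ d := (:1 :+ k) :* d) refl (fromℕ K) δ ⟩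
        fromℕ (suc K) * δ        ∎) , empty

      outer : ∀ {s s′} → Outer ℛ I π (suc p) s s′ → ¬ Nonempty (H p (prefix π s)) →
              ∀ K → Few s K → Shortened s s′ K
      outer (exit empty) light K _ = 0 , ≡.refl , *-nonNeg (fromℕ-nonNeg K) 0≤δ , empty
        where
        0≤δ : 0# ≤ δ
        0≤δ = *-nonNeg (*-nonNeg (<⇒≤ (*-positive 0<c2 0<c2)) (<⇒≤ 0<ℓ)) 0≤Λ
      outer {s} (iter nonempty _ _) light zero few =
        ⊥-elim (ℕₚ.<⇒≱ few (ℕₚ.*-monoˡ-≤ 1 (nonempty⇒1≤∣∣ nonempty)))
      outer {s} (iter {s′ = s₁} nonempty run rest) light (suc K) few =
        append K length (outer rest (light-mono p (prefix-mono π s≤s₁) light) K (few-suc s s₁ K (inner-stops run) few))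
        where
        length : ∃[ d ] s₁ ≡ d ℕ.+ s × fromℕ d ≤ δ
        length = inner-length light nonempty run
        s≤s₁ : s ℕ.≤ s₁
        s≤s₁ = ≡.subst (s ℕ.≤_) (≡.sym (proj₁ (proj₂ length))) (ℕₚ.m≤n+m s (proj₁ length))

    -- The cost of a phase: K inner iterations of length 4 ℓ Λ at weight B_p, rewritten with 2 B_p =
    -- 3 B_{p+1} and ℓ B_{p+1} ≤ 3 o.
    Γ : ℕ → Carrier
    Γ K = fromℕ K * Λ * (c2 * c3) * (c3 * o)

    Γ-≥0 : ∀ K → 0# ≤ Γ K
    Γ-≥0 K = *-nonNeg (*-nonNeg (*-nonNeg (fromℕ-nonNeg K) 0≤Λ) (<⇒≤ (*-positive 0<c2 0<c3))) (<⇒≤ (*-positive 0<c3 0<o))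

    -- L - 1 is still too short, so L B overshoots 2 o by at most B, and B ≤ W ≤ o.
    phase-length : ∀ p → ¬ ¬ (∃[ L ] c2 * o ≤ fromℕ L * B p × fromℕ L * B p ≤ c3 * o)
    phase-length p none = archimedean (c2 * o) (B-pos p) λ (N , 2o<NB) → none (least (first-step enough? ¬0 N (<⇒≤ 2o<NB)))
      where
      Enough : ℕ → Set
      Enough l = c2 * o ≤ fromℕ l * B p
      enough? : ∀ l → Dec (Enough l)
      enough? l = (c2 * o) ≤? (fromℕ l * B p)
      ¬0 : ¬ Enough 0
      ¬0 2o≤0 = ≤⇒≯ (≤-trans 2o≤0 (≤-reflexive (zeroˡ _))) (*-positive 0<c2 0<o)
      least : ∀ {N} → ∃[ l ] suc l ℕ.≤ N × ¬ Enough l × Enough (suc l) →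
              ∃[ L ] c2 * o ≤ fromℕ L * B p × fromℕ L * B p ≤ c3 * o
      least (l , _ , ¬enough , enough) = suc l , enough , (begin
        (1# + fromℕ l) * B p     ≈⟨ trans (distribʳ _ _ _) (+-congʳ (*-identityˡ _)) ⟩
        B p + fromℕ l * B p      ≤⟨ +-mono-≤ (≤-trans (B≤W p) (fromℕ-mono-≤ (W≤objective σ))) (<⇒≤ (≰⇒> ¬enough)) ⟩
        o + c2 * o               ≈⟨ trans (+-congʳ (sym (*-identityˡ _))) (sym (distribʳ o 1# c2)) ⟩
        c3 * o                   ∎)

    phase-cost : ∀ p K L d u → fromℕ L * B (suc p) ≤ c3 * o → fromℕ d ≤ fromℕ K * (c2 * c2 * fromℕ L * Λ) →
                 fromℕ u ≤ B p → fromℕ (d ℕ.* u) ≤ Γ K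
    phase-cost p K L d u LB≤3o d≤ u≤B = begin
      fromℕ (d ℕ.* u)                                    ≈⟨ fromℕ-* d u ⟩
      fromℕ d * fromℕ u                                  ≤⟨ *-mono-≤ (fromℕ-nonNeg u) (≤-trans (fromℕ-nonNeg d) d≤) d≤ u≤B ⟩
      fromℕ K * (c2 * c2 * ℓ * Λ) * B p
        ≈⟨ solve 5 (λ k c l λ′ b → k :* (c :* c :* l :* λ′) :* b := k :* λ′ :* c :* l :* (c :* b)) refl (fromℕ K) c2 ℓ Λ (B p) ⟩
      fromℕ K * Λ * c2 * ℓ * (c2 * B p)                  ≈⟨ *-congˡ (B-suc p) ⟩
      fromℕ K * Λ * c2 * ℓ * (c3 * B (suc p))
        ≈⟨ solve 6 (λ k λ′ c l d b → k :* λ′ :* c :* l :* (d :* b) :=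
            k :* λ′ :* (c :* d) :* (l :* b)) refl (fromℕ K) Λ c2 ℓ c3 (B (suc p)) ⟩
      fromℕ K * Λ * (c2 * c3) * (ℓ * B (suc p))
        ≤⟨ *-monoʳ-≤ (*-nonNeg (*-nonNeg (fromℕ-nonNeg K) 0≤Λ) (<⇒≤ (*-positive 0<c2 0<c3))) LB≤3o ⟩
      Γ K                                                ∎
      where
      ℓ : Carrier
      ℓ = fromℕ L

    -- From phase P on, every agent has unsatisfied weight at most W / n if n ≤ W,
    -- and none at all if W ≤ n.
    late : ∀ {P q s} i → (n ℕ.⊓ W′) ℕ.* 2 ℕ.^ P ℕ.< 3 ℕ.^ P → P ℕ.≤ q → ¬ Nonempty (H q (prefix π s)) →
           remaining π i s ℕ.≤ W′
    late {P} {q} {s} i x2<3 P≤q light = ℕₚ.≤-trans (remaining-≤-n π i s) (by-cases (ℕₚ.⊓-sel n W′))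
      where
      u : ℕ
      u = uW (prefix π s) i
      3u≤2W : 3 ℕ.^ q ℕ.* u ℕ.≤ 2 ℕ.^ q ℕ.* W′
      3u≤2W = light-≤ℕ q (prefix π s) light i
      grow : ∀ x d → x ℕ.* 2 ℕ.^ P ℕ.< 3 ℕ.^ P → x ℕ.* 2 ℕ.^ (d ℕ.+ P) ℕ.< 3 ℕ.^ (d ℕ.+ P)
      grow x zero    h = h
      grow x (suc d) h = ℕₚ.≤-<-trans
        (ℕₚ.≤-trans (ℕₚ.≤-reflexive (≡.trans (≡.sym (ℕₚ.*-assoc x 2 y)) (≡.trans (≡.cong (ℕ._* y) (ℕₚ.*-comm x 2))
            (ℕₚ.*-assoc 2 x y)))) (ℕₚ.m≤n+m _ (x ℕ.* y)))
        (ℕₚ.*-monoʳ-< 3 (grow x d h))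
        where y = 2 ℕ.^ (d ℕ.+ P)
      x2<3′ : (n ℕ.⊓ W′) ℕ.* 2 ℕ.^ q ℕ.< 3 ℕ.^ q
      x2<3′ = ≡.subst (λ r → (n ℕ.⊓ W′) ℕ.* 2 ℕ.^ r ℕ.< 3 ℕ.^ r) (ℕₚ.m∸n+n≡m P≤q) (grow (n ℕ.⊓ W′) (q ℕ.∸ P) x2<3)
      instance
        3^q≢0 : ℕ.NonZero (3 ℕ.^ q)
        3^q≢0 = ℕₚ.m^n≢0 3 q
      by-cases : n ℕ.⊓ W′ ≡ n ⊎ n ℕ.⊓ W′ ≡ W′ → n ℕ.* u ℕ.≤ W′
      by-cases (inj₁ ⊓≡n) = ℕₚ.*-cancelˡ-≤ (3 ℕ.^ q) (ℕₚ.≤-trans (ℕₚ.≤-reflexive (swap (3 ℕ.^ q) n u))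
        (ℕₚ.≤-trans (ℕₚ.*-monoʳ-≤ n 3u≤2W) (ℕₚ.≤-trans (ℕₚ.≤-reflexive (≡.sym (ℕₚ.*-assoc n (2 ℕ.^ q) W′)))
          (ℕₚ.*-monoˡ-≤ W′ (ℕₚ.<⇒≤ (≡.subst (λ x → x ℕ.* 2 ℕ.^ q ℕ.< 3 ℕ.^ q) ⊓≡n x2<3′))))))
        where
        swap : ∀ a b c → a ℕ.* (b ℕ.* c) ≡ b ℕ.* (a ℕ.* c)
        swap = N.solve 3 (λ a b c → a N.:* (b N.:* c) N.:= b N.:* (a N.:* c)) ≡.refl
          where module N = +-*-Solver
      by-cases (inj₂ ⊓≡W) = ≡.subst (λ v → n ℕ.* v ℕ.≤ W′) (≡.sym u≡0) (≡.subst (ℕ._≤ W′) (≡.sym (ℕₚ.*-zeroʳ n)) ℕ.z≤n)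
        where
        -- Integrality of the weights enters here: once the threshold is below 1, the unsatisfied
        -- weight vanishes.
        u<1 : u ℕ.< 1
        u<1 = ℕₚ.*-cancelˡ-< (3 ℕ.^ q) u 1 (ℕₚ.≤-<-trans 3u≤2W (ℕₚ.<-≤-trans
          (≡.subst (ℕ._< 3 ℕ.^ q) (≡.trans (≡.cong (ℕ._* 2 ℕ.^ q) ⊓≡W) (ℕₚ.*-comm W′ (2 ℕ.^ q))) x2<3′)
          (ℕₚ.≤-reflexive (≡.sym (ℕₚ.*-identityʳ (3 ℕ.^ q))))))
        u≡0 : u ≡ 0
        u≡0 = ℕₚ.n<1⇒n≡0 u<1

    -- Phase `suc q` starts with no agent heavy for `q`, so every unsatisfied weight in it is at
    -- most B_q. Only the phases up to P are charged Γ; from there on `late` bounds all that remains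
    -- by W.
    run : ∀ i P K → (n ℕ.⊓ W′) ℕ.* 2 ℕ.^ P ℕ.< 3 ℕ.^ P → k ℕ.* 3 ℕ.^ K ℕ.< 4 ℕ.^ K →
          ∀ {q s} → Run ℛ I π (suc q) s → ¬ Nonempty (H q (prefix π s)) →
          fromℕ (remaining π i s) ≤ fromℕ (P ℕ.∸ q) * Γ K + fromℕ W′
    run i P K x2<3 k3<4 {q} {s} (done sat) light = begin
      fromℕ (remaining π i s)             ≡⟨ ≡.cong fromℕ (remaining≡0 π i s sat) ⟩
      0#                                  ≤⟨ +-nonNeg (*-nonNeg (fromℕ-nonNeg (P ℕ.∸ q)) (Γ-≥0 K)) (fromℕ-nonNeg W′) ⟩
      fromℕ (P ℕ.∸ q) * Γ K + fromℕ W′    ∎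
    run i P K x2<3 k3<4 {q} {s} (next {s′ = s′} _ phase rest) light = by-cases (P ℕₚ.≤? q)
      where
      bound : ∀ L → q ℕ.< P → fromℕ L * B (suc q) ≤ c3 * o →
              (∃[ d ] s′ ≡ d ℕ.+ s × fromℕ d ≤ fromℕ K * (c2 * c2 * fromℕ L * Λ) × ¬ Nonempty (H (suc q) (prefix π s′))) →
              fromℕ (remaining π i s) ≤ fromℕ (P ℕ.∸ q) * Γ K + fromℕ W′
      bound L q<P LB≤3o (d , s′≡d+s , d≤Kδ , light′) = begin
        fromℕ (remaining π i s)
          ≤⟨ fromℕ-mono-≤ (remaining-step π i d s) ⟩
        fromℕ (remaining π i (d ℕ.+ s) ℕ.+ d ℕ.* uW (prefix π s) i)
          ≈⟨ fromℕ-+ (remaining π i (d ℕ.+ s)) (d ℕ.* uW (prefix π s) i) ⟩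
        fromℕ (remaining π i (d ℕ.+ s)) + fromℕ (d ℕ.* uW (prefix π s) i)
          ≡⟨ ≡.cong (λ r → fromℕ (remaining π i r) + fromℕ (d ℕ.* uW (prefix π s) i)) s′≡d+s ⟨
        fromℕ (remaining π i s′) + fromℕ (d ℕ.* uW (prefix π s) i)
          ≤⟨ +-mono-≤ (run i P K x2<3 k3<4 rest light′) (phase-cost q K L d (uW (prefix π s) i) LB≤3o d≤Kδ (light-≤ q (prefix π s) light i)) ⟩
        fromℕ (P ℕ.∸ suc q) * Γ K + fromℕ W′ + Γ K
          ≈⟨ solve 3 (λ p g w → p :* g :+ w :+ g := (:1 :+ p) :* g :+ w) refl (fromℕ (P ℕ.∸ suc q)) (Γ K) (fromℕ W′) ⟩
        fromℕ (suc (P ℕ.∸ suc q)) * Γ K + fromℕ W′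
          ≡⟨ ≡.cong (λ r → fromℕ r * Γ K + fromℕ W′) (≡.sym (ℕₚ.+-∸-assoc 1 q<P)) ⟩
        fromℕ (P ℕ.∸ q) * Γ K + fromℕ W′ ∎

      few : ∣ H (suc q) (prefix π s) ∣ ℕ.* 3 ℕ.^ K ℕ.< 4 ℕ.^ K
      few = ℕₚ.≤-<-trans (ℕₚ.*-monoˡ-≤ (3 ℕ.^ K) (∣p∣≤n (H (suc q) (prefix π s)))) k3<4

      by-cases : Dec (P ℕ.≤ q) → fromℕ (remaining π i s) ≤ fromℕ (P ℕ.∸ q) * Γ K + fromℕ W′
      by-cases (yes P≤q) = begin
        fromℕ (remaining π i s)             ≤⟨ fromℕ-mono-≤ (late {P} {q} {s} i x2<3 P≤q light) ⟩
        fromℕ W′                            ≤⟨ ≤-by _ (*-nonNeg (fromℕ-nonNeg (P ℕ.∸ q)) (Γ-≥0 K)) (+-comm _ _) ⟩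
        fromℕ (P ℕ.∸ q) * Γ K + fromℕ W′    ∎
      -- Assuming the strict reverse inequality turns the goal into a contradiction, in which the
      -- doubly negated choice of L may be opened.
      by-cases (no P≰q) = ≮⇒≥ λ lt → phase-length (suc q) λ (L , 2o≤LB , LB≤3o) →
        ≤⇒≯ (bound L (ℕₚ.≰⇒> P≰q) LB≤3o (outer q L 2o≤LB phase light K few)) lt

    objective-≤ : ∀ P K → (n ℕ.⊓ W′) ℕ.* 2 ℕ.^ P ℕ.< 3 ℕ.^ P → k ℕ.* 3 ℕ.^ K ℕ.< 4 ℕ.^ K → IsBAGOutput ℛ I π →
                  fromℕ (objective ℛ I π) ≤ fromℕ P * Γ K + c2 * o
    objective-≤ P K x2<3 k3<4 output = maxℕ-induction (λ v → fromℕ v ≤ fromℕ P * Γ K + c2 * o)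
      (+-nonNeg (*-nonNeg (fromℕ-nonNeg P) (Γ-≥0 K)) (<⇒≤ (*-positive 0<c2 0<o))) (agentCost π) λ i → begin
      fromℕ (agentCost π i)                                    ≤⟨ fromℕ-mono-≤ (agentCost-≤ π i) ⟩
      fromℕ (remaining π i 0 ℕ.+ sumℕ (w i))                   ≈⟨ fromℕ-+ (remaining π i 0) (sumℕ (w i)) ⟩
      fromℕ (remaining π i 0) + fromℕ (sumℕ (w i))
        ≤⟨ +-mono-≤ (run i P K x2<3 k3<4 output (light-0 _)) (fromℕ-mono-≤ (agentWeight≤W i)) ⟩
      -- One W is the tail after phase P, the other the unit per function left out of `remaining`.
      fromℕ P * Γ K + fromℕ W′ + fromℕ W′                      ≤⟨ +-mono-≤ (+-monoʳ-≤ _ W≤o) W≤o ⟩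
      fromℕ P * Γ K + o + o
        ≈⟨ solve 2 (λ g o → g :+ o :+ o := g :+ (:1 :+ (:1 :+ :0)) :* o) refl (fromℕ P * Γ K) o ⟩
      fromℕ P * Γ K + c2 * o                                   ∎
      where
      W≤o : fromℕ W′ ≤ o
      W≤o = fromℕ-mono-≤ (W≤objective σ)

-- From powers of 4/3 to logarithms, and the final constant.

module ApproximationRatio (ℛ : Reals) where
  open Reals ℛ hiding (zero)
  open OrderedField ℛ
  open Logarithm ℛ
  open LogPotential ℛ
  open Reasoning

  -- The two factors 4 come from `log-bound` for the numbers of phases and of inner iterations, 2 ·
  -- 5 from Λ by `scale-≤`, 2 · 3 · 3 from `Γ`, and the final 2 from the two W in `objective-≤`.
  C : Carrier
  C = (fromℕ 4 * fromℕ 4 * (two * fromℕ 5)) * ((fromℕ 2 * fromℕ 3) * fromℕ 3) + fromℕ 2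

  0<C : 0# < C
  0<C = +-pos-nonNeg (*-positive (*-positive (*-positive (fromℕ-suc-pos 3) (fromℕ-suc-pos 3)) (*-positive 0<2 (fromℕ-suc-pos 4)))
    (*-positive (*-positive (fromℕ-suc-pos 1) (fromℕ-suc-pos 2)) (fromℕ-suc-pos 2))) (fromℕ-nonNeg 2)

  3^*ρ^≈4^ : ∀ N → fromℕ (3 ℕ.^ N) * ρ ^ N ≈ fromℕ (4 ℕ.^ N)
  3^*ρ^≈4^ zero    = *-identityʳ _
  3^*ρ^≈4^ (suc N) = begin-equality
    fromℕ (3 ℕ.* 3 ℕ.^ N) * (ρ * ρ ^ N)          ≈⟨ *-congʳ (fromℕ-* 3 (3 ℕ.^ N)) ⟩
    fromℕ 3 * fromℕ (3 ℕ.^ N) * (ρ * ρ ^ N)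
      ≈⟨ solve 4 (λ a b c d → a :* b :* (c :* d) := (a :* c) :* (b :* d)) refl (fromℕ 3) (fromℕ (3 ℕ.^ N)) ρ (ρ ^ N) ⟩
    fromℕ 3 * ρ * (fromℕ (3 ℕ.^ N) * ρ ^ N)      ≈⟨ *-cong 3*ρ≈4 (3^*ρ^≈4^ N) ⟩
    fromℕ 4 * fromℕ (4 ℕ.^ N)                    ≈⟨ fromℕ-* 4 (4 ℕ.^ N) ⟨
    fromℕ (4 ℕ.* 4 ℕ.^ N)                        ∎

  2*ρ≤3 : fromℕ 2 * ρ ≤ fromℕ 3
  2*ρ≤3 = *-cancelˡ-≤ (fromℕ-suc-pos 2) (begin
    fromℕ 3 * (fromℕ 2 * ρ)   ≈⟨ solve 3 (λ a b c → a :* (b :* c) := b :* (a :* c)) refl (fromℕ 3) (fromℕ 2) ρ ⟩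
    fromℕ 2 * (fromℕ 3 * ρ)   ≈⟨ *-congˡ 3*ρ≈4 ⟩
    fromℕ 2 * fromℕ 4         ≈⟨ fromℕ-* 2 4 ⟨
    fromℕ 8                   ≤⟨ fromℕ-mono-≤ (ℕₚ.n≤1+n 8) ⟩
    fromℕ 9                   ≈⟨ fromℕ-* 3 3 ⟩
    fromℕ 3 * fromℕ 3         ∎)

  -- Since 4/3 ≤ 3/2, phases too can be counted in powers of ρ; only the constant suffers.
  2^*ρ^≤3^ : ∀ N → fromℕ (2 ℕ.^ N) * ρ ^ N ≤ fromℕ (3 ℕ.^ N)
  2^*ρ^≤3^ zero    = ≤-reflexive (*-identityʳ _)
  2^*ρ^≤3^ (suc N) = begin
    fromℕ (2 ℕ.* 2 ℕ.^ N) * (ρ * ρ ^ N)          ≈⟨ *-congʳ (fromℕ-* 2 (2 ℕ.^ N)) ⟩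
    fromℕ 2 * fromℕ (2 ℕ.^ N) * (ρ * ρ ^ N)
      ≈⟨ solve 4 (λ a b c d → a :* b :* (c :* d) := (a :* c) :* (b :* d)) refl (fromℕ 2) (fromℕ (2 ℕ.^ N)) ρ (ρ ^ N) ⟩
    fromℕ 2 * ρ * (fromℕ (2 ℕ.^ N) * ρ ^ N)
      ≤⟨ *-mono-≤ (*-nonNeg (fromℕ-nonNeg (2 ℕ.^ N)) (<⇒≤ (^-pos 0<ρ N))) (fromℕ-nonNeg 3) 2*ρ≤3 (2^*ρ^≤3^ N) ⟩
    fromℕ 3 * fromℕ (3 ℕ.^ N)                    ≈⟨ fromℕ-* 3 (3 ℕ.^ N) ⟨
    fromℕ (3 ℕ.* 3 ℕ.^ N)                        ∎

  <ρ^⇒*<ℕ : ∀ x a b N → 1 ℕ.≤ a → fromℕ a * ρ ^ N ≤ fromℕ b → fromℕ x < ρ ^ N → x ℕ.* a ℕ.< b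
  <ρ^⇒*<ℕ x a b N 1≤a aρ≤b x<ρ = fromℕ-cancel-< (begin-strict
    fromℕ (x ℕ.* a)       ≈⟨ trans (fromℕ-* x a) (*-comm _ _) ⟩
    fromℕ a * fromℕ x     <⟨ *-monoʳ-< (fromℕ-pos 1≤a) x<ρ ⟩
    fromℕ a * ρ ^ N       ≤⟨ aρ≤b ⟩
    fromℕ b               ∎)

  1≤1+ : ∀ {y} → 0# ≤ y → 1# ≤ 1# + y
  1≤1+ {y} 0≤y = ≤-by y 0≤y refl

  scale-≤ : ∀ N {y} → 0# ≤ y → fromℕ N ≤ fromℕ 4 * (1# + y) → two * fromℕ (suc N) ≤ two * fromℕ 5 * (1# + y)
  scale-≤ N {y} 0≤y N≤4y = begin
    two * (1# + fromℕ N)                       ≤⟨ *-monoʳ-≤ (<⇒≤ 0<2) (+-mono-≤ (1≤1+ 0≤y) N≤4y) ⟩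
    two * ((1# + y) + fromℕ 4 * (1# + y))
      ≈⟨ solve 3 (λ t f y → t :* (y :+ f :* y) := t :* (:1 :+ f) :* y) refl two (fromℕ 4) (1# + y) ⟩
    two * fromℕ 5 * (1# + y)                   ∎

  combine : ∀ {P K Λ α β γ o} → 0# ≤ K → 0# ≤ Λ → 0# ≤ o → 1# ≤ α → 1# ≤ β → 1# ≤ γ →
    P ≤ fromℕ 4 * α → K ≤ fromℕ 4 * β → Λ ≤ two * fromℕ 5 * γ →
    P * (K * Λ * (fromℕ 2 * fromℕ 3) * (fromℕ 3 * o)) + fromℕ 2 * o ≤ C * γ * α * β * o
  combine {P} {K} {Λ} {α} {β} {γ} {o} 0≤K 0≤Λ 0≤o 1≤α 1≤β 1≤γ P≤ K≤ Λ≤ = begin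
    P * (K * Λ * (d2 * d3) * (d3 * o)) + d2 * o
      ≈⟨ solve 6 (λ p k l a b o → p :* (k :* l :* (a :* b) :* (b :* o)) :+ a :* o :=
          p :* (k :* l) :* (a :* b :* b :* o) :+ a :* (:1 :* (:1 :* :1)) :* o) refl P K Λ d2 d3 o ⟩
    -- The ones hold the places of the three logarithmic factors, each at least 1, which absorb the
    -- additive 2 o.
    P * (K * Λ) * (d2 * d3 * d3 * o) + d2 * (1# * (1# * 1#)) * o
      ≤⟨ +-mono-≤
          (*-monoˡ-≤ (*-nonNeg 0≤18 0≤o)
            (*-mono-≤ (*-nonNeg 0≤K 0≤Λ) (*-nonNeg (fromℕ-nonNeg 4) 0≤α) P≤
              (*-mono-≤ 0≤Λ (*-nonNeg (fromℕ-nonNeg 4) 0≤β) K≤ Λ≤)))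
          (*-monoˡ-≤ 0≤o (*-monoʳ-≤ (fromℕ-nonNeg 2)
            (*-mono-≤ (≤-trans 0≤1 (≤-reflexive (sym (*-identityʳ 1#)))) 0≤γ 1≤γ (*-mono-≤ 0≤1 0≤α 1≤α 1≤β)))) ⟩
    d4 * α * (d4 * β * (t * d5 * γ)) * (d2 * d3 * d3 * o) + d2 * (γ * (α * β)) * o
      ≈⟨ eq ⟩
    C * γ * α * β * o ∎
    where
    d2 d3 d4 d5 t : Carrier
    d2 = fromℕ 2
    d3 = fromℕ 3
    d4 = fromℕ 4
    d5 = fromℕ 5
    t = two
    0≤18 : 0# ≤ d2 * d3 * d3
    0≤18 = *-nonNeg (*-nonNeg (fromℕ-nonNeg 2) (fromℕ-nonNeg 3)) (fromℕ-nonNeg 3)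
    0≤α = ≤-trans 0≤1 1≤α
    0≤β = ≤-trans 0≤1 1≤β
    0≤γ = ≤-trans 0≤1 1≤γ
    eq : d4 * α * (d4 * β * (t * d5 * γ)) * (d2 * d3 * d3 * o) + d2 * (γ * (α * β)) * o ≈ C * γ * α * β * o
    eq = solve 8 (λ α β γ c t x y o →
      c :* α :* (c :* β :* (t :* γ)) :* (x :* y :* y :* o) :+ x :* (γ :* (α :* β)) :* o :=
      (c :* c :* t :* ((x :* y) :* y) :+ x) :* γ :* α :* β :* o) refl α β γ d4 (t * d5) d2 d3 o

  module _ {n k m : ℕ} (I : SRMA ℛ n k m) where
    open SRMA I
    open CoverTime ℛ I using (1≤W)

    ε≤1 : ∀ {ε} → IsMinNonzeroMarginal ℛ I ε → ε ≤ 1#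
    ε≤1 {ε} ε-min with IsMinNonzeroMarginal.attained ε-min
    ... | inj₂ (_ , ε≈1) = ≤-reflexive ε≈1
    ... | inj₁ (i , j , S , S′ , _ , Δ≈ε) = begin
      ε                      ≈⟨ Δ≈ε ⟨
      f i j S′ - f i j S     ≤⟨ ≤-by (f i j S) (f-≥0 i j S) (solve 2 (λ s t → t := (t :- s) :+ s) refl (f i j S) (f i j S′)) ⟩
      f i j S′               ≤⟨ f-≤1 i j S′ ⟩
      1#                     ∎

    bound : ∀ ε → IsMinNonzeroMarginal ℛ I ε → ∀ π → IsBAGOutput ℛ I π → ∀ σ →
      ∀ ln1/ε lnmin lnk → IsLn (1# / ε) ln1/ε → IsLn (fromℕ (n ℕ.⊓ W ℛ I)) lnmin → IsLn (fromℕ k) lnk →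
      fromℕ (objective ℛ I π) ≤ C * (1# + ln1/ε) * (1# + lnmin) * (1# + lnk) * fromℕ (objective ℛ I σ)
    bound ε ε-min π output σ ln1/ε lnmin lnk is-ln1/ε is-lnmin is-lnk = ≮⇒≥ λ lt →
      log-bound is-ln1/ε 1≤1/ε λ (M , 1/ε<ρᴹ , M≤) →
      log-bound is-lnmin 1≤min λ (P , min<ρᴾ , P≤) →
      log-bound is-lnk 1≤k λ (K , k<ρᴷ , K≤) →
      ≤⇒≯ (final M P K 1/ε<ρᴹ M≤ min<ρᴾ P≤ k<ρᴷ K≤) lt
      where
      0<ε : 0# < ε
      0<ε = IsMinNonzeroMarginal.positive ε-min
      1≤1/ε : 1# ≤ 1# / ε
      1≤1/ε = ≤-/ 0<ε (≤-trans (≤-reflexive (*-identityʳ ε)) (ε≤1 ε-min))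
      1≤fromℕ : ∀ {x} → 1 ℕ.≤ x → 1# ≤ fromℕ x
      1≤fromℕ {x} 1≤x = ≤-trans (≤-reflexive (sym (+-identityʳ 1#))) (fromℕ-mono-≤ {1} {x} 1≤x)
      1≤min : 1# ≤ fromℕ (n ℕ.⊓ W ℛ I)
      1≤min = 1≤fromℕ (ℕₚ.⊓-glb 0<n 1≤W)
      1≤k : 1# ≤ fromℕ k
      1≤k = 1≤fromℕ 0<k
      final : ∀ M P K → 1# / ε < ρ ^ M → fromℕ M ≤ fromℕ 4 * (1# + ln1/ε) →
              fromℕ (n ℕ.⊓ W ℛ I) < ρ ^ P → fromℕ P ≤ fromℕ 4 * (1# + lnmin) →
              fromℕ k < ρ ^ K → fromℕ K ≤ fromℕ 4 * (1# + lnk) →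
              fromℕ (objective ℛ I π) ≤ C * (1# + ln1/ε) * (1# + lnmin) * (1# + lnk) * fromℕ (objective ℛ I σ)
      final M P K 1/ε<ρᴹ M≤ min<ρᴾ P≤ k<ρᴷ K≤ = ≤-trans
        (Phases.Iterations.objective-≤ ℛ I ε-min (potential M 0<ε 1≤ρᴹε) π σ P K
          (<ρ^⇒*<ℕ (n ℕ.⊓ W ℛ I) (2 ℕ.^ P) (3 ℕ.^ P) P (ℕₚ.m^n>0 2 P) (2^*ρ^≤3^ P) min<ρᴾ)
          (<ρ^⇒*<ℕ k (3 ℕ.^ K) (4 ℕ.^ K) K (ℕₚ.m^n>0 3 K) (≤-reflexive (3^*ρ^≈4^ K)) k<ρᴷ)
          output)
        (combine (fromℕ-nonNeg K) (*-nonNeg (<⇒≤ 0<2) (fromℕ-nonNeg (suc M))) (fromℕ-nonNeg (objective ℛ I σ))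
          (1≤1+ (ln-nonNeg is-lnmin 1≤min)) (1≤1+ (ln-nonNeg is-lnk 1≤k)) (1≤1+ 0≤ln1/ε) P≤ K≤ (scale-≤ M 0≤ln1/ε M≤))
        where
        0≤ln1/ε : 0# ≤ ln1/ε
        0≤ln1/ε = ln-nonNeg is-ln1/ε 1≤1/ε
        1≤ρᴹε : 1# ≤ ρ ^ M * ε
        1≤ρᴹε = begin
          1#               ≈⟨ y*[x/y]≈x 0<ε ⟨
          ε * (1# / ε)     ≤⟨ *-monoʳ-≤ (<⇒≤ 0<ε) (<⇒≤ 1/ε<ρᴹ) ⟩
          ε * ρ ^ M        ≈⟨ *-comm _ _ ⟩
          ρ ^ M * ε        ∎

theorem3 : (ℛ : Reals) → let open Reals ℛ in
    ∃[ C ] 0# < C ×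
    (∀ {n k m : ℕ} (I : SRMA ℛ n k m) (ε : Carrier) → IsMinNonzeroMarginal ℛ I ε →
    ∀ (π : Permutation′ n) → IsBAGOutput ℛ I π →
    ∀ (opt : ℕ) → IsOPT ℛ I opt →
    ∀ (ln1/ε lnmin lnk : Carrier) →
    IsLn (1# / ε) ln1/ε → IsLn (fromℕ (n ℕ.⊓ W ℛ I)) lnmin → IsLn (fromℕ k) lnk →
    fromℕ (objective ℛ I π) ≤ C * (1# + ln1/ε) * (1# + lnmin) * (1# + lnk) * fromℕ opt)
theorem3 ℛ = C , 0<C , λ { I ε ε-min π output opt ((σ , ≡.refl) , _) → bound I ε ε-min π output σ }
  where open ApproximationRatio ℛ
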